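{- Let $n,m,\ell$ be integers with $n-1\ge m\ge \ell\ge 0$. Then $$\sum_{j=0}^{n-m-2}\binom{n-m+\ell-3-2j}{\ell-1-j}\,\mathcal Y_n\big(2^{\{m-\ell+1+j\}},1^{\{n-m+\ell-3-2j\}}\big)=\frac{1}{n(m+1)}\binom{n-1}{m}\left(\binom{n}{\ell}-\binom{m+1}{\ell}\right).$$ In particular (case $\ell=1$), $\mathcal Y_n(2^{\{m\}},1^{\{n-m-2\}})=\frac{n-m-1}{n(m+1)}\binom{n-1}{m}$.
   Context: Let $\zeta_n=e^{2\pi\sqrt{ -1}/n}$. For integers $s_1,\dots,s_m$, define $\mathfrak Z_n(s_1,\dots,s_m):=\sum_{1\le i_1<\cdots<i_m\le n-1}\prod_{k=1}^{m}(1-\zeta_n^{i_k})^{ -s_k}$ (equal to $1$ if $m=0$ and to $0$ if $m>n-1$). Define $\mathcal Y_n(s_1,\dots,s_m):=\sum_{\sigma}\mathfrak Z_n(\sigma)$, where $\sigma$ runs over all distinct sequences obtained by rearranging $(s_1,\dots,s_m)$ (each distinct rearrangement counted once); $\mathcal Y_n$ of the empty sequence is $1$. Notation: $a^{\{k\}}$ denotes the block $a,a,\dots,a$ of length $k$; any term $\mathcal Y_n(\dots)$ in which some block has negative length is interpreted as $0$. Binomial coefficients $\binom{a}{b}$ are $0$ when $b<0$ or $b>a\ge0$. -}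

module Defs where

open import Algebra.Apartness.Bundles using (HeytingCommutativeRing; HeytingField)
open import Algebra.Bundles using (CommutativeRing; Semiring)
open import Algebra.Definitions using (Invertible)
import Algebra.Definitions.RawSemiring as RawSemiringOps
import Algebra.Properties.Semiring.Sum as SemiringSum
open import Data.Fin.Base as Fin using (Fin; toℕ)
import Data.Fin.Properties as Fin
open import Data.Integer.Base as ℤ using (ℤ; +_; -[1+_])
import Data.Integer.Properties as ℤ
open import Data.List.Base as List
  using (List; []; _∷_; _++_; length; replicate; concatMap; deduplicate; filter; allFin; cartesianProductWith)
open import Data.List.Membership.Propositional using (_∈_; find; lose)
open import Data.List.Membership.Propositional.Properties
  using (∈-map⁺; ∈-map⁻; ∈-concatMap⁺; ∈-concatMap⁻; ∈-deduplicate⁺; ∈-deduplicate⁻; ∈-∃++)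
open import Data.List.Properties using (≡-dec)
open import Data.List.Relation.Binary.Permutation.Propositional
  using (_↭_; prep; swap; ↭-refl; ↭-sym; ↭-trans)
open import Data.List.Relation.Binary.Permutation.Propositional.Properties
  using (shift; drop-mid; ∈-resp-↭; ↭-empty-inv)
open import Data.List.Relation.Unary.Any using (here; there)
open import Data.List.Relation.Unary.Unique.Propositional using (Unique)
import Data.List.Relation.Unary.Unique.DecPropositional.Properties as Unique
open import Data.Maybe.Base as Maybe using (Maybe; just; nothing; maybe)
open import Data.Nat.Base as ℕ using (ℕ; zero; suc; pred; NonZero; _<_; s<s)
open import Data.Nat.Combinatorics using (_C_)
open import Data.Product.Base using (_×_; _,_; proj₁)
open import Data.Vec.Base as Vec using (Vec; []; _∷_)
open import Data.Vec.Relation.Unary.AllPairs using (AllPairs; allPairs?)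
open import Function.Bundles using (_⇔_; mk⇔)
open import Level using (_⊔_)
open import Relation.Binary.PropositionalEquality using (_≡_; refl)

-- For a < 0 ≤ b this is the usual extension, a(a-1)⋯(a-b+1)/b! = (-1)^b C(b-a-1, b).
binomial : ℤ → ℤ → ℤ
binomial _        -[1+ _ ] = + 0
binomial (+ a)    (+ b)    = + (a C b)
binomial -[1+ a ] (+ b)    = (ℤ.- + 1) ℤ.^ b ℤ.* + ((a ℕ.+ b) C b)

tuples : ∀ N m → List (Vec (Fin N) m)
tuples N zero    = [] ∷ []
tuples N (suc m) = cartesianProductWith _∷_ (allFin N) (tuples N m)

increasingTuples : ∀ N m → List (Vec (Fin N) m)
increasingTuples N m = filter (allPairs? Fin._<?_) (tuples N m)

module _ {a} {A : Set a} where

  insertions : A → List A → List (List A)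
  insertions x []       = (x ∷ []) ∷ []
  insertions x (y ∷ ys) = (x ∷ y ∷ ys) ∷ List.map (y ∷_) (insertions x ys)

  permutations : List A → List (List A)
  permutations []       = [] ∷ []
  permutations (x ∷ xs) = concatMap (insertions x) (permutations xs)

  ∈-insertions⁺ : ∀ x ys zs → ys ++ x ∷ zs ∈ insertions x (ys ++ zs)
  ∈-insertions⁺ x []       []       = here refl
  ∈-insertions⁺ x []       (z ∷ zs) = here refl
  ∈-insertions⁺ x (y ∷ ys) zs       = there (∈-map⁺ (y ∷_) (∈-insertions⁺ x ys zs))

  ∈-insertions⁻ : ∀ x ys {zs} → zs ∈ insertions x ys → zs ↭ x ∷ ys
  ∈-insertions⁻ x []       (here refl) = ↭-refl
  ∈-insertions⁻ x (y ∷ ys) (here refl) = ↭-refl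
  ∈-insertions⁻ x (y ∷ ys) (there p) with ∈-map⁻ (y ∷_) p
  ... | _ , q , refl = ↭-trans (prep y (∈-insertions⁻ x ys q)) (swap y x ↭-refl)

  ∈-permutations⁻ : ∀ xs {σ} → σ ∈ permutations xs → σ ↭ xs
  ∈-permutations⁻ []       (here refl) = ↭-refl
  ∈-permutations⁻ (x ∷ xs) p with find (∈-concatMap⁻ (insertions x) p)
  ... | τ , q , r = ↭-trans (∈-insertions⁻ x τ r) (prep x (∈-permutations⁻ xs q))

  ∈-permutations⁺ : ∀ xs {σ} → σ ↭ xs → σ ∈ permutations xs
  ∈-permutations⁺ [] p with ↭-empty-inv p
  ... | refl = here refl
  ∈-permutations⁺ (x ∷ xs) p with ∈-∃++ (∈-resp-↭ (↭-sym p) (here refl))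
  ... | ys , zs , refl = ∈-concatMap⁺ (insertions x)
    (lose (∈-permutations⁺ xs (drop-mid ys [] p)) (∈-insertions⁺ x ys zs))

rearrangements : List ℤ → List (List ℤ)
rearrangements s = deduplicate (≡-dec ℤ._≟_) (permutations s)

rearrangements-unique : ∀ s → Unique (rearrangements s)
rearrangements-unique s = Unique.deduplicate-! (≡-dec ℤ._≟_) (permutations s)

∈-rearrangements : ∀ s σ → (σ ∈ rearrangements s) ⇔ (σ ↭ s)
∈-rearrangements s σ = mk⇔
  (λ p → ∈-permutations⁻ s (∈-deduplicate⁻ (≡-dec ℤ._≟_) (permutations s) p))
  (λ p → ∈-deduplicate⁺ (≡-dec ℤ._≟_) (∈-permutations⁺ s p))

-- The sequence a₁^{k₁}, a₂^{k₂}, … given as (a₁ , k₁) ∷ (a₂ , k₂) ∷ …;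
-- `nothing` if some length kᵢ is negative.
blocks : List (ℤ × ℤ) → Maybe (List ℤ)
blocks []                    = just []
blocks ((a , + k) ∷ bs)      = Maybe.map (replicate k a ++_) (blocks bs)
blocks ((a , -[1+ _ ]) ∷ bs) = nothing

module FieldOps {c ℓ₁ ℓ₂} (K : HeytingField c ℓ₁ ℓ₂) where

  open HeytingField K

  commutativeRing : CommutativeRing c ℓ₁
  commutativeRing = HeytingCommutativeRing.commutativeRing heytingCommutativeRing

  open RawSemiringOps (Semiring.rawSemiring (CommutativeRing.semiring commutativeRing)) public
    using (_^_) renaming (_×_ to _·_)
  open SemiringSum (CommutativeRing.semiring commutativeRing) public
    using (sum; sum-syntax)

  fromℕ : ℕ → Carrier
  fromℕ k = k · 1#

  fromℤ : ℤ → Carrier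
  fromℤ (+ k)    = fromℕ k
  fromℤ -[1+ k ] = - fromℕ (suc k)

  sumₗ : ∀ {a} {A : Set a} → List A → (A → Carrier) → Carrier
  sumₗ xs f = List.foldr (λ x acc → f x + acc) 0# xs

  CharacteristicZero : Set ℓ₂
  CharacteristicZero = ∀ k → .{{NonZero k}} → fromℕ k # 0#

  record IsPrimitiveRoot (n : ℕ) (ζ : Carrier) : Set (ℓ₁ ⊔ ℓ₂) where
    field
      ζ^n≈1 : ζ ^ n ≈ 1#
      ζ^k#1 : ∀ k → 0 < k → k < n → ζ ^ k # 1#

  infixr 8 _^ᶻ_
  _^ᶻ_ : ∀ {x} → Invertible _≈_ 1# _*_ x → ℤ → Carrier
  _^ᶻ_ {x} _     (+ k)    = x ^ k
  (x⁻¹ , _)   ^ᶻ -[1+ k ] = x⁻¹ ^ suc k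

-- With K = ℂ and ζ = e^{2πi/n}, 𝔷 and 𝒴 are the sums 𝔷ₙ and 𝒴ₙ.
module CyclotomicSums {c ℓ₁ ℓ₂} (K : HeytingField c ℓ₁ ℓ₂)
  (char0 : FieldOps.CharacteristicZero K)
  (n : ℕ) (ζ : HeytingField.Carrier K) (prim : FieldOps.IsPrimitiveRoot K n ζ) where

  open HeytingField K hiding (_≈_; _*_; _-_)
  open HeytingField K public using (_≈_; _*_; _-_)
  open FieldOps K public
  open IsPrimitiveRoot prim

  -- Apartness from 0# gives the inverse of fromℕ k - 0#, which is ≈ fromℕ k.
  infix 8 1/_
  1/_ : (k : ℕ) → .{{NonZero k}} → Carrier
  1/ k = proj₁ (#⇒invertible (char0 k))

  -- An element i of Fin (pred n) stands for the index i + 1 ∈ {1, …, n - 1}.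
  index : Fin (pred n) → ℕ
  index i = suc (toℕ i)

  index<n : ∀ i → index i < n
  index<n i = go n (Fin.toℕ<n i)
    where
    go : ∀ n {k} → k < pred n → suc k < n
    go (suc n) k<n = s<s k<n

  1-ζ^_ : (i : Fin (pred n)) → Invertible _≈_ 1# _*_ (1# - ζ ^ index i)
  1-ζ^ i = #⇒invertible (#-sym (ζ^k#1 (index i) ℕ.z<s (index<n i)))

  term : ∀ {m} → Vec ℤ m → Vec (Fin (pred n)) m → Carrier
  term []       []       = 1#
  term (s ∷ ss) (i ∷ is) = (1-ζ^ i) ^ᶻ (ℤ.- s) * term ss is

  𝔷 : List ℤ → Carrier
  𝔷 s = sumₗ (increasingTuples (pred n) (length s)) (term (Vec.fromList s))

  𝒴 : List ℤ → Carrier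
  𝒴 s = sumₗ (rearrangements s) 𝔷

  𝒴ᵇ : List (ℤ × ℤ) → Carrier
  𝒴ᵇ bs = maybe 𝒴 0# (blocks bs)

{-# OPTIONS --safe #-}

-- Put y_i = (1 - ζ^i)^(-1) for 1 ≤ i ≤ n - 1, so that 𝒴(2^{a},1^{b}) is the monomial symmetric function
-- m_{2^a 1^b}(y).  Since 1 - y_i = - ζ^i y_i, the numbers - y_i are n - 1 distinct roots of (t+1)^n - t^n,
-- and Vieta gives n e_k(y) = C(n, k+1).  Expanding a product of elementary symmetric functions,
--   e_m e_{n-1-ℓ} = Σ_a C(n+m-ℓ-1-2a, m-a) m_{2^a 1^{n+m-ℓ-1-2a}},
-- where the terms with a < m-ℓ vanish for lack of variables, the term a = m-ℓ is a multiple of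
-- e_{n-1} e_{m-ℓ}, and the rest is the left-hand side of the theorem.
module Submission where

open import Defs
open import Algebra.Apartness.Bundles using (HeytingField)
open import Algebra.Bundles using (CommutativeRing; CommutativeSemiring)
open import Algebra.Definitions using (Invertible)
import Algebra.Definitions.RawSemiring as RawSemiringOps
import Algebra.Properties.CommutativeSemiring.Exp as Exp
import Algebra.Properties.Ring as RingProperties
import Algebra.Properties.Semiring.Mult as Mult
import Algebra.Properties.Semiring.Sum as SemiringSum
import Algebra.Solver.Ring.NaturalCoefficients.Default as SemiringSolver
open import Data.Fin.Base as Fin using (Fin; zero; suc; toℕ)
import Data.Fin.Properties as Fin
open import Data.Integer.Base as ℤ using (ℤ; +_)
import Data.Integer.Tactic.RingSolver as ℤSolver
open import Data.List.Base as List using (List; []; _∷_; _++_; length; replicate)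
open import Data.List.Membership.Propositional using (_∈_)
open import Data.List.Membership.Propositional.Properties
  using (∈-map⁺; ∈-map⁻; ∈-++⁺ˡ; ∈-++⁺ʳ; ∈-++⁻; ∈-filter⁺; ∈-filter⁻; ∈-cartesianProductWith⁺; ∈-allFin)
open import Data.List.Membership.Propositional.Properties.WithK using (unique∧set⇒bag)
import Data.List.Properties as List
open import Data.List.Relation.Binary.BagAndSetEquality using (∼bag⇒↭)
open import Data.List.Relation.Binary.Disjoint.Propositional using (Disjoint)
open import Data.List.Relation.Binary.Permutation.Propositional as ↭
  using (_↭_; ↭-refl; ↭-sym; ↭-trans; prep; swap)
open import Data.List.Relation.Binary.Permutation.Propositional.Properties using (shift)
open import Data.List.Relation.Unary.All using ([])
open import Data.List.Relation.Unary.AllPairs using ([]; _∷_)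
open import Data.List.Relation.Unary.Any using (here)
open import Data.List.Relation.Unary.Unique.Propositional using (Unique)
import Data.List.Relation.Unary.Unique.Propositional.Properties as Unique
open import Data.Nat.Base as ℕ
  using (ℕ; zero; suc; pred; NonZero; _≤_; _<_; _∸_; _!; z≤n; s≤s; z<s; s<s)
open import Data.Nat.Combinatorics
  using (_C_; nCk+nC[k+1]≡[n+1]C[k+1]; nCn≡1; nC1≡n; k>n⇒nCk≡0; nCk≡n!/k![n-k]!; k![n∸k]!∣n!; nCk≡nC[n∸k])
open import Data.Nat.DivMod using (m/n*n≡m)
import Data.Nat.Properties as ℕ
open import Data.Nat.Properties using (m*n≢0)
import Data.Nat.Tactic.RingSolver as ℕSolver
open import Data.Product.Base using (∃; _×_; _,_; proj₁; proj₂)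
open import Data.Sum.Base using (inj₁; inj₂)
open import Data.Vec.Base as Vec using (Vec; []; _∷_)
import Data.Vec.Properties as Vec
open import Data.Vec.Relation.Unary.All as All using (All; []; _∷_)
import Data.Vec.Relation.Unary.All.Properties as Allₚ
open import Data.Vec.Relation.Unary.AllPairs as AllPairs using (AllPairs; allPairs?; []; _∷_)
import Data.Vec.Relation.Unary.AllPairs.Properties as AllPairsₚ
open import Function.Base using (_∘_)
open import Function.Bundles using (_⇔_; mk⇔; Equivalence)
open import Relation.Binary.PropositionalEquality as ≡ using (_≡_; _≢_)
import Relation.Binary.Reasoning.Setoid as SetoidReasoning

-- The right-hand side appears after multiplying the expansion by n^2: the product e_m e_{n-1-ℓ}
-- becomes C(n, m+1) C(n, ℓ), the term a = m-ℓ becomes C(n, m-ℓ+1) C(n-1-m+ℓ, ℓ) = C(n, m+1) C(m+1,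
-- ℓ), and (m+1) C(n, m+1) = n C(n-1, m). The natural numbers k = m-ℓ and r = n-1-m stand in for the
-- inequalities: n = k+ℓ+r+1, and differences of the parameters become sums. Two obstacles shape the
-- rest. Equality in a Heyting field is not decidable, so distinctness of the roots takes the form
-- that y_i - y_j is cancellable, which is deduced from the invertibility of ζ^(j-i) - 1. And `𝒴` is
-- defined by filtering tuples and deduplicating permutations, which gives no recursion on the
-- variables; both lists are exchanged, up to order, for lists that split on the first index or the
-- first letter.

-- Products of elementary symmetric functions

module SymmetricSums {c ℓ} (R : CommutativeSemiring c ℓ) where

  open CommutativeSemiring R hiding (zero)
  open RawSemiringOps rawSemiring using () renaming (_×_ to _·_)
  open Mult semiring using (×-homo-+)
  open SemiringSum semiring using (sum)
  open SemiringSolver R using (solve; _:=_; _:+_; _:*_; con)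
  open SetoidReasoning setoid

  fromℕ : ℕ → Carrier
  fromℕ k = k · 1#

  -- Multiplication by the variable, if `f` is read as the coefficients of a power series. The value
  -- 0 at index 0 spares `e` a case distinction on the degree.
  delay : (ℕ → Carrier) → ℕ → Carrier
  delay f zero    = 0#
  delay f (suc k) = f k

  e : ∀ {N} → (Fin N → Carrier) → ℕ → Carrier
  e {zero}  y zero    = 1#
  e {zero}  y (suc k) = 0#
  e {suc N} y k       = e (y ∘ suc) k + y zero * delay (e (y ∘ suc)) k

  e-0 : ∀ {N} (y : Fin N → Carrier) → e y 0 ≈ 1#
  e-0 {zero}  y = refl
  e-0 {suc N} y = trans (+-cong (e-0 (y ∘ suc)) (zeroʳ _)) (+-identityʳ _)

  e-large : ∀ {N} (y : Fin N → Carrier) {k} → N < k → e y k ≈ 0#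
  e-large {zero}  y {suc k} _         = refl
  e-large {suc N} y {suc k} (s≤s N<k) = trans
    (+-cong (e-large (y ∘ suc) (ℕ.m<n⇒m<1+n N<k))
            (trans (*-congˡ (e-large (y ∘ suc) N<k)) (zeroʳ _)))
    (+-identityʳ _)

  -- What remains to be distributed when the first variable has exponent 1 or 2: one part 1, or one
  -- part 2, is used up, and there is no contribution if none is left.
  addOne addTwo : (ℕ → ℕ → Carrier) → ℕ → ℕ → Carrier
  addOne f a      = delay (f a)
  addTwo f zero _ = 0#
  addTwo f (suc a) = f a

  -- The monomial symmetric function m_{2^a 1^b} at y.
  mono : ∀ {N} → (Fin N → Carrier) → ℕ → ℕ → Carrier
  mono {zero}  y zero    zero    = 1#
  mono {zero}  y zero    (suc b) = 0#
  mono {zero}  y (suc a) b       = 0#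
  mono {suc N} y a       b       =
    mono (y ∘ suc) a b
    + (y zero * addOne (mono (y ∘ suc)) a b + y zero * y zero * addTwo (mono (y ∘ suc)) a b)

  -- A monomial of this shape needs `a + b` different variables.
  mono-large : ∀ {N} (y : Fin N → Carrier) a b → N < a ℕ.+ b → mono y a b ≈ 0#
  mono-large {zero} y zero    (suc b) _ = refl
  mono-large {zero} y (suc a) b       _ = refl
  mono-large {suc N} y a b N<a+b = begin
    mono y′ a b + (y zero * addOne (mono y′) a b + y zero * y zero * addTwo (mono y′) a b)
      ≈⟨ +-cong (mono-large y′ a b (ℕ.<⇒≤ N<a+b))
                (+-cong (*-congˡ (one b N<a+b)) (*-congˡ (two a N<a+b))) ⟩
    0# + (y zero * 0# + y zero * y zero * 0#)
      ≈⟨ solve 1 (λ x → con 0 :+ (x :* con 0 :+ x :* x :* con 0) := con 0) refl (y zero) ⟩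
    0# ∎
    where
    y′ : Fin N → Carrier
    y′ = y ∘ suc
    one : ∀ b → suc N < a ℕ.+ b → addOne (mono y′) a b ≈ 0#
    one zero    _ = refl
    one (suc b) p = mono-large y′ a b (ℕ.s≤s⁻¹ (≡.subst (suc N <_) (ℕ.+-suc a b) p))
    two : ∀ a → suc N < a ℕ.+ b → addTwo (mono y′) a b ≈ 0#
    two zero    _ = refl
    two (suc a) p = mono-large y′ a b (ℕ.s≤s⁻¹ p)

  -- Σ_a C(p+q-2-2a, p-1-a) f a (p+q-2-2a).  The indices are shifted by one (for f a b = m_{2^a 1^b} this
  -- is e_{p-1} e_{q-1}) so that the recursion shifting f down by one square also covers empty sums.
  expand : (ℕ → ℕ → Carrier) → ℕ → ℕ → Carrier
  expand f zero    q       = 0#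
  expand f (suc p) zero    = 0#
  expand f (suc p) (suc q) = fromℕ ((p ℕ.+ q) C p) * f 0 (p ℕ.+ q) + expand (f ∘ suc) p q

  expand-cong : ∀ {f g} → (∀ a b → f a b ≈ g a b) → ∀ p q → expand f p q ≈ expand g p q
  expand-cong f≈g zero    q       = refl
  expand-cong f≈g (suc p) zero    = refl
  expand-cong f≈g (suc p) (suc q) =
    +-cong (*-congˡ (f≈g 0 _)) (expand-cong (λ a → f≈g (suc a)) p q)

  expand-zeroʳ : ∀ f p → expand f p zero ≈ 0#
  expand-zeroʳ f zero    = refl
  expand-zeroʳ f (suc p) = refl

  expand-linear : ∀ x z f g h p q →
    expand (λ a b → f a b + (x * g a b + z * h a b)) p q
    ≈ expand f p q + (x * expand g p q + z * expand h p q)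
  expand-linear x z f g h zero q =
    solve 2 (λ x z → con 0 := con 0 :+ (x :* con 0 :+ z :* con 0)) refl x z
  expand-linear x z f g h (suc p) zero =
    solve 2 (λ x z → con 0 := con 0 :+ (x :* con 0 :+ z :* con 0)) refl x z
  expand-linear x z f g h (suc p) (suc q) =
    trans (+-congˡ (expand-linear x z (f ∘ suc) (g ∘ suc) (h ∘ suc) p q))
      (solve 9 (λ x z k f g h F G H →
          k :* (f :+ (x :* g :+ z :* h)) :+ (F :+ (x :* G :+ z :* H))
          := (k :* f :+ F) :+ (x :* (k :* g :+ G) :+ z :* (k :* h :+ H)))
        refl x z (fromℕ ((p ℕ.+ q) C p)) (f 0 (p ℕ.+ q)) (g 0 (p ℕ.+ q)) (h 0 (p ℕ.+ q))
          (expand (f ∘ suc) p q) (expand (g ∘ suc) p q) (expand (h ∘ suc) p q))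

  -- Pascal's rule: a variable of exponent 1 in a product of two elementary symmetric functions
  -- comes from exactly one of the factors, whose degree then drops by one.
  expand-addOne : ∀ f p q →
    expand (addOne f) (suc p) (suc q) ≈ expand f p (suc q) + expand f (suc p) q
  expand-addOne f zero zero = +-congʳ (zeroʳ _)
  expand-addOne f zero (suc q) = sym (+-identityˡ _)
  expand-addOne f (suc p) zero = begin
    fromℕ ((suc p ℕ.+ 0) C suc p) * f 0 (p ℕ.+ 0) + expand (addOne (f ∘ suc)) (suc p) 0
      ≡⟨ ≡.cong (λ k → fromℕ k * f 0 (p ℕ.+ 0) + 0#) (≡.trans (C-diag (suc p)) (≡.sym (C-diag p))) ⟩
    fromℕ ((p ℕ.+ 0) C p) * f 0 (p ℕ.+ 0) + 0#
      ≈⟨ +-congʳ (trans (sym (+-identityʳ _)) (+-congˡ (sym (expand-zeroʳ (f ∘ suc) p)))) ⟩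
    fromℕ ((p ℕ.+ 0) C p) * f 0 (p ℕ.+ 0) + expand (f ∘ suc) p 0 + 0# ∎
    where
    C-diag : ∀ p → (p ℕ.+ 0) C p ≡ 1
    C-diag p = ≡.trans (≡.cong (_C p) (ℕ.+-identityʳ p)) (nCn≡1 p)
  expand-addOne f (suc p) (suc q) = begin
    fromℕ ((suc p ℕ.+ suc q) C suc p) * f 0 (p ℕ.+ suc q) + expand (addOne (f ∘ suc)) (suc p) (suc q)
      ≈⟨ +-cong (*-congʳ pascal) (expand-addOne (f ∘ suc) p q) ⟩
    (fromℕ ((p ℕ.+ suc q) C p) + fromℕ ((suc p ℕ.+ q) C suc p)) * f 0 (p ℕ.+ suc q)
      + (expand (f ∘ suc) p (suc q) + expand (f ∘ suc) (suc p) q)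
      ≈⟨ solve 5 (λ k k′ f F F′ → (k :+ k′) :* f :+ (F :+ F′) := (k :* f :+ F) :+ (k′ :* f :+ F′))
           refl _ _ _ _ _ ⟩
    (fromℕ ((p ℕ.+ suc q) C p) * f 0 (p ℕ.+ suc q) + expand (f ∘ suc) p (suc q))
      + (fromℕ ((suc p ℕ.+ q) C suc p) * f 0 (p ℕ.+ suc q) + expand (f ∘ suc) (suc p) q)
      ≡⟨ ≡.cong (λ s → (fromℕ ((p ℕ.+ suc q) C p) * f 0 (p ℕ.+ suc q) + expand (f ∘ suc) p (suc q))
           + (fromℕ ((suc p ℕ.+ q) C suc p) * f 0 s + expand (f ∘ suc) (suc p) q)) (ℕ.+-suc p q) ⟩
    expand f (suc p) (suc (suc q)) + expand f (suc (suc p)) (suc q) ∎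
    where
    pascal : fromℕ ((suc p ℕ.+ suc q) C suc p)
             ≈ fromℕ ((p ℕ.+ suc q) C p) + fromℕ ((suc p ℕ.+ q) C suc p)
    pascal = trans
      (reflexive (≡.cong fromℕ (≡.trans (≡.sym (nCk+nC[k+1]≡[n+1]C[k+1] (p ℕ.+ suc q) p))
        (≡.cong (λ s → (p ℕ.+ suc q) C p ℕ.+ s C suc p) (ℕ.+-suc p q)))))
      (×-homo-+ 1# ((p ℕ.+ suc q) C p) _)

  expand-addTwo : ∀ f p q → expand (addTwo f) (suc p) (suc q) ≈ expand f p q
  expand-addTwo f p q = trans (+-congʳ (zeroʳ _)) (+-identityˡ _)

  -- Induction on the variables, sorting the product by powers of the first one, `x`. The
  -- coefficients of 1, `x` and `x * x` match the three summands of `mono`; for `x * x` both degrees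
  -- drop. The binomial in `expand` counts which variables of exponent 1 come from the first factor.
  e-product : ∀ {N} (y : Fin N → Carrier) p q → e y p * e y q ≈ expand (mono y) (suc p) (suc q)
  e-product {zero} y zero zero = trans (*-congʳ (sym (+-identityʳ _))) (sym (+-identityʳ _))
  e-product {zero} y zero (suc q) = begin
    1# * 0#  ≈⟨ zeroʳ _ ⟩
    0# ≈⟨ sym (+-identityʳ _) ⟩
    0# + 0# ≈⟨ +-congʳ (sym (zeroʳ _)) ⟩
    fromℕ (suc q C 0) * 0# + 0# ∎
  e-product {zero} y (suc p) q = begin
    0# * e y q  ≈⟨ zeroˡ _ ⟩
    0# ≈⟨ sym (+-identityʳ _) ⟩
    0# + 0# ≈⟨ +-cong (sym (zeroʳ _)) (sym (vanish (suc p) q)) ⟩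
    fromℕ ((suc p ℕ.+ q) C suc p) * 0# + expand (mono y ∘ suc) (suc p) q ∎
    where
    vanish : ∀ p q → expand (λ _ _ → 0#) p q ≈ 0#
    vanish zero    q       = refl
    vanish (suc p) zero    = refl
    vanish (suc p) (suc q) = trans (+-cong (zeroʳ _) (vanish p q)) (+-identityˡ _)
  e-product {suc N} y p q = begin
    (e y′ p + x * delay (e y′) p) * (e y′ q + x * delay (e y′) q)
      ≈⟨ solve 5 (λ x a a′ b b′ → (a :+ x :* a′) :* (b :+ x :* b′)
           := a :* b :+ (x :* (a′ :* b :+ a :* b′) :+ x :* x :* (a′ :* b′))) refl x _ _ _ _ ⟩
    e y′ p * e y′ q + (x * (delay (e y′) p * e y′ q + e y′ p * delay (e y′) q)
      + x * x * (delay (e y′) p * delay (e y′) q))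
      ≈⟨ +-cong (e-product y′ p q)
           (+-cong (*-congˡ (trans (+-cong (left p q) (right p q)) (sym (expand-addOne (mono y′) p q))))
                   (*-congˡ (trans (both p q) (sym (expand-addTwo (mono y′) p q))))) ⟩
    expand (mono y′) (suc p) (suc q) + (x * expand (addOne (mono y′)) (suc p) (suc q)
      + x * x * expand (addTwo (mono y′)) (suc p) (suc q))
      ≈⟨ sym (expand-linear x (x * x) (mono y′) (addOne (mono y′)) (addTwo (mono y′)) (suc p) (suc q)) ⟩
    expand (mono y) (suc p) (suc q) ∎
    where
    x : Carrier
    x = y zero
    y′ : Fin N → Carrier
    y′ = y ∘ suc
    left : ∀ p q → delay (e y′) p * e y′ q ≈ expand (mono y′) p (suc q)
    left zero    q = zeroˡ _
    left (suc p) q = e-product y′ p q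
    right : ∀ p q → e y′ p * delay (e y′) q ≈ expand (mono y′) (suc p) q
    right p zero    = zeroʳ _
    right p (suc q) = e-product y′ p q
    both : ∀ p q → delay (e y′) p * delay (e y′) q ≈ expand (mono y′) p q
    both zero    q       = zeroˡ _
    both (suc p) zero    = zeroʳ _
    both (suc p) (suc q) = e-product y′ p q

  -- In degrees `k + p` and `k + q`, the term with `a` squares has `2k + p + q - a` parts, more than
  -- `k + p + q` exactly when `a < k`. The binomials of the terms that survive depend on `p` and `q`
  -- alone.
  expand-skip : ∀ f k p q → (∀ a b → (k ℕ.+ p) ℕ.+ q < a ℕ.+ b → f a b ≈ 0#) →
    expand f (suc (k ℕ.+ p)) (suc (k ℕ.+ q)) ≈ expand (f ∘ (k ℕ.+_)) (suc p) (suc q)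
  expand-skip f zero    p q f-large = refl
  expand-skip f (suc k) p q f-large = begin
    _ * f 0 (suc (k ℕ.+ p ℕ.+ suc (k ℕ.+ q))) + expand (f ∘ suc) (suc (k ℕ.+ p)) (suc (k ℕ.+ q))
      ≈⟨ +-cong (trans (*-congˡ (f-large 0 _ (s≤s (ℕ.+-monoʳ-< (k ℕ.+ p) (s≤s (ℕ.m≤n+m q k)))))) (zeroʳ _))
           (expand-skip (f ∘ suc) k p q (λ a b lt → f-large (suc a) b (s≤s lt))) ⟩
    0# + expand (f ∘ (suc k ℕ.+_)) (suc p) (suc q)
      ≈⟨ +-identityˡ _ ⟩
    expand (f ∘ (suc k ℕ.+_)) (suc p) (suc q) ∎

  -- `expand f ℓ r` has only as many terms as the smaller of `ℓ` and `r`, whereas the sum in the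
  -- theorem always has `r`. The first condition removes the surplus; the second compares terms only
  -- where `ℓ - 1 - j` and `r - 1 - j` are natural numbers `p` and `q`.
  sum-expand : ∀ f (g : ℕ → Carrier) ℓ r →
    (∀ d → g (ℓ ℕ.+ d) ≈ 0#) →
    (∀ j p q → ℓ ≡ suc j ℕ.+ p → r ≡ suc j ℕ.+ q → g j ≈ fromℕ ((p ℕ.+ q) C p) * f j (p ℕ.+ q)) →
    sum {r} (g ∘ toℕ) ≈ expand f ℓ r
  sum-expand f g zero    zero    beyond within = refl
  sum-expand f g zero    (suc r) beyond within =
    trans (+-cong (beyond 0) (sum-expand f (g ∘ suc) zero r (beyond ∘ suc) (λ _ _ _ ()))) (+-identityˡ 0#)
  sum-expand f g (suc ℓ) zero    beyond within = refl
  sum-expand f g (suc ℓ) (suc r) beyond within = +-cong (within 0 ℓ r ≡.refl ≡.refl)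
    (sum-expand (f ∘ suc) (g ∘ suc) ℓ r beyond
      (λ j p q eq eq′ → within (suc j) p q (≡.cong suc eq) (≡.cong suc eq′)))

-- Vieta's formulas and the polynomial (t+1)^n - t^n

module Roots {c ℓ} (R : CommutativeRing c ℓ) where

  open CommutativeRing R hiding (zero)
  open RawSemiringOps (CommutativeSemiring.rawSemiring commutativeSemiring) using (_^_)
  open Mult semiring using (×-homo-+)
  open RingProperties ring
  open SemiringSolver commutativeSemiring using (solve; _:=_; _:+_; _:*_)
  open SetoidReasoning setoid
  open SymmetricSums commutativeSemiring

  -- The value at t of the polynomial c 0 t^N + c 1 t^(N-1) + ⋯ + c N.
  horner : (ℕ → Carrier) → ℕ → Carrier → Carrier
  horner c zero    t = c 0
  horner c (suc N) t = c (suc N) + t * horner c N t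

  horner-cong : ∀ {c d} → (∀ k → c k ≈ d k) → ∀ N t → horner c N t ≈ horner d N t
  horner-cong c≈d zero    t = c≈d 0
  horner-cong c≈d (suc N) t = +-cong (c≈d (suc N)) (*-congˡ (horner-cong c≈d N t))

  horner-+ : ∀ c d N t → horner (λ k → c k + d k) N t ≈ horner c N t + horner d N t
  horner-+ c d zero    t = refl
  horner-+ c d (suc N) t = trans (+-congˡ (*-congˡ (horner-+ c d N t)))
    (solve 5 (λ a b t x y → a :+ b :+ t :* (x :+ y) := (a :+ t :* x) :+ (b :+ t :* y)) refl _ _ _ _ _)

  -- `horner` peels off the constant term; here the leading term is peeled off instead, which is the
  -- one that cancels in (t+1)^n - t^n.
  horner-suc : ∀ c N t → horner c (suc N) t ≈ horner (c ∘ suc) N t + t ^ suc N * c 0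
  horner-suc c zero t = +-congˡ (*-congʳ (sym (*-identityʳ t)))
  horner-suc c (suc N) t = trans (+-congˡ (*-congˡ (horner-suc c N t)))
    (solve 5 (λ a t x p z → a :+ t :* (x :+ p :* z) := (a :+ t :* x) :+ (t :* p) :* z) refl _ _ _ _ _)

  -- Synthetic division by t - r, with terms moved across so that no subtraction occurs.
  horner-divide : ∀ c N r t →
    horner c (suc N) t + r * horner (λ k → horner c k r) N t
    ≈ horner c (suc N) r + t * horner (λ k → horner c k r) N t
  horner-divide c zero r t =
    solve 4 (λ a b r t → a :+ t :* b :+ r :* b := a :+ r :* b :+ t :* b) refl _ _ _ _
  horner-divide c (suc N) r t = begin
    a + t * h + r * (b + t * q)
      ≈⟨ solve 6 (λ a t h r b q → a :+ t :* h :+ r :* (b :+ t :* q)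
           := a :+ r :* b :+ t :* (h :+ r :* q)) refl _ _ _ _ _ _ ⟩
    a + r * b + t * (h + r * q)
      ≈⟨ +-congˡ (*-congˡ (horner-divide c N r t)) ⟩
    a + r * b + t * (b + t * q) ∎
    where
    a b h q : Carrier
    a = c (suc (suc N))
    b = horner c (suc N) r
    h = horner c (suc N) t
    q = horner (λ k → horner c k r) N t

  -- Non-vanishing in the form in which division by a root uses it. It makes sense in any
  -- commutative ring, where neither inverses nor an apartness relation are at hand.
  Cancellable : Carrier → Set _
  Cancellable x = ∀ {z} → x * z ≈ 0# → z ≈ 0#

  -- The hypotheses say that the polynomial is c 0 ∏ (t + y i).
  vieta : ∀ {N} c (y : Fin N → Carrier) →
    (∀ i j → i Fin.< j → Cancellable (y i - y j)) →
    (∀ i → horner c N (- y i) ≈ 0#) →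
    ∀ k → k ≤ N → c k ≈ c 0 * e y k
  vieta {zero} c y distinct root zero z≤n = sym (*-identityʳ _)
  vieta {suc N} c y distinct root = coefficient
    where
    r : Carrier
    r = - y zero
    y′ : Fin N → Carrier
    y′ = y ∘ suc
    -- The partial Horner values at the root `r` are the coefficients of the quotient by `t - r`;
    -- the value at `suc N` is the remainder.
    q : ℕ → Carrier
    q k = horner c k r

    -- With `t = - y′ i`, the factor `y zero - y′ i` is `t - r`. Its product with the quotient
    -- vanishes because `c` vanishes at both `t` and `r`.
    q-root : ∀ i → horner q N (- y′ i) ≈ 0#
    q-root i = distinct zero (suc i) z<s (begin
      (y zero - y′ i) * h              ≈⟨ distribʳ _ _ _ ⟩
      y zero * h + t * h               ≈⟨ +-congˡ (sym (+-identityˡ _)) ⟩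
      y zero * h + (0# + t * h)        ≈⟨ +-congˡ (+-congʳ (sym (root zero))) ⟩
      y zero * h + (horner c (suc N) r + t * h)
        ≈⟨ +-congˡ (sym (horner-divide c N r t)) ⟩
      y zero * h + (horner c (suc N) t + r * h)
        ≈⟨ +-congˡ (trans (+-congʳ (root (suc i))) (+-identityˡ _)) ⟩
      y zero * h + r * h               ≈⟨ sym (distribʳ _ _ _) ⟩
      (y zero + r) * h                 ≈⟨ *-congʳ (-‿inverseʳ _) ⟩
      0# * h                           ≈⟨ zeroˡ _ ⟩
      0#                               ∎)
      where
      t h : Carrier
      t = - y′ i
      h = horner q N t

    quotient : ∀ k → k ≤ suc N → q k ≈ c 0 * e y′ k
    quotient k k≤1+N with ℕ.m≤n⇒m<n∨m≡n k≤1+N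
    ... | inj₁ k<1+N = vieta q y′ (λ i j i<j → distinct (suc i) (suc j) (s<s i<j)) q-root k (ℕ.s≤s⁻¹ k<1+N)
    -- The remainder and `e y′ (suc N)` are both zero. Including this index lets the last
    -- coefficient follow the same recurrence as the others.
    ... | inj₂ ≡.refl = trans (root zero) (sym (trans (*-congˡ (e-large y′ (ℕ.n<1+n N))) (zeroʳ _)))

    coefficient : ∀ k → k ≤ suc N → c k ≈ c 0 * e y k
    coefficient zero    _ = sym (trans (*-congˡ (e-0 y)) (*-identityʳ _))
    coefficient (suc k) k<1+N = begin
      c (suc k)                                ≈⟨ sym (+-identityʳ _) ⟩
      c (suc k) + 0#                           ≈⟨ +-congˡ (sym (trans (*-congʳ (-‿inverseˡ _)) (zeroˡ _))) ⟩
      c (suc k) + (r + y zero) * q k           ≈⟨ +-congˡ (distribʳ _ _ _) ⟩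
      c (suc k) + (r * q k + y zero * q k)     ≈⟨ sym (+-assoc _ _ _) ⟩
      q (suc k) + y zero * q k
        ≈⟨ +-cong (quotient (suc k) k<1+N) (*-congˡ (quotient k (ℕ.<⇒≤ k<1+N))) ⟩
      c 0 * e y′ (suc k) + y zero * (c 0 * e y′ k)
        ≈⟨ solve 4 (λ c a x b → c :* a :+ x :* (c :* b) := c :* (a :+ x :* b)) refl _ _ _ _ ⟩
      c 0 * (e y′ (suc k) + y zero * e y′ k)   ∎

  pascal : ∀ n k → fromℕ (suc n C suc k) ≈ fromℕ (n C suc k) + fromℕ (n C k)
  pascal n k = trans (reflexive (≡.cong fromℕ (≡.sym (nCk+nC[k+1]≡[n+1]C[k+1] n k))))
    (trans (×-homo-+ 1# (n C k) _) (+-comm _ _))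

  horner-pascal : ∀ n k t →
    horner (fromℕ ∘ (suc n C_)) (suc k) t
    ≈ horner (fromℕ ∘ (n C_)) (suc k) t + horner (fromℕ ∘ (n C_)) k t
  horner-pascal n k t = begin
    horner (fromℕ ∘ (suc n C_)) (suc k) t
      ≈⟨ horner-suc (fromℕ ∘ (suc n C_)) k t ⟩
    horner (fromℕ ∘ (suc n C_) ∘ suc) k t + t ^ suc k * fromℕ 1
      ≈⟨ +-congʳ (trans (horner-cong (pascal n) k t) (horner-+ _ (fromℕ ∘ (n C_)) k t)) ⟩
    horner (fromℕ ∘ (n C_) ∘ suc) k t + horner (fromℕ ∘ (n C_)) k t + t ^ suc k * fromℕ 1
      ≈⟨ solve 3 (λ a b x → a :+ b :+ x := a :+ x :+ b) refl _ _ _ ⟩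
    horner (fromℕ ∘ (n C_) ∘ suc) k t + t ^ suc k * fromℕ 1 + horner (fromℕ ∘ (n C_)) k t
      ≈⟨ +-congʳ (sym (horner-suc (fromℕ ∘ (n C_)) k t)) ⟩
    horner (fromℕ ∘ (n C_)) (suc k) t + horner (fromℕ ∘ (n C_)) k t ∎

  binomial-theorem : ∀ n t → horner (fromℕ ∘ (n C_)) n t ≈ (t + 1#) ^ n
  binomial-theorem zero t = +-identityʳ 1#
  binomial-theorem (suc n) t = begin
    horner (fromℕ ∘ (suc n C_)) (suc n) t  ≈⟨ horner-pascal n n t ⟩
    -- Row `n` read to length `suc n` has the additional constant term `n C suc n`, which is 0.
    fromℕ (n C suc n) + t * h + h
      ≈⟨ +-cong (trans (+-congʳ (reflexive (≡.cong fromℕ (k>n⇒nCk≡0 (ℕ.n<1+n n))))) (+-identityˡ _))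
                (sym (*-identityˡ h)) ⟩
    t * h + 1# * h                         ≈⟨ sym (distribʳ h t 1#) ⟩
    (t + 1#) * h                           ≈⟨ *-congˡ (binomial-theorem n t) ⟩
    (t + 1#) ^ suc n                       ∎
    where
    h : Carrier
    h = horner (fromℕ ∘ (n C_)) n t

  -- The coefficients `suc N C suc k` are those of (t+1)^(N+1) - t^(N+1) after the leading terms
  -- cancel. This is where the shift by one in n e_k = C(n, k+1) originates.
  horner-difference : ∀ N t → (t + 1#) ^ suc N ≈ t ^ suc N →
    horner (fromℕ ∘ (suc N C_) ∘ suc) N t ≈ 0#
  horner-difference N t eq = +-cancelʳ (t ^ suc N) _ _ (begin
    horner (fromℕ ∘ (suc N C_) ∘ suc) N t + t ^ suc N
      ≈⟨ +-congˡ (sym (trans (*-congˡ (+-identityʳ 1#)) (*-identityʳ _))) ⟩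
    horner (fromℕ ∘ (suc N C_) ∘ suc) N t + t ^ suc N * fromℕ 1
      ≈⟨ sym (horner-suc (fromℕ ∘ (suc N C_)) N t) ⟩
    horner (fromℕ ∘ (suc N C_)) (suc N) t  ≈⟨ binomial-theorem (suc N) t ⟩
    (t + 1#) ^ suc N                       ≈⟨ eq ⟩
    t ^ suc N                              ≈⟨ sym (+-identityˡ _) ⟩
    0# + t ^ suc N                         ∎)

-- Rearrangements of twos and ones

-- Allows a list produced by filtering or deduplicating to be replaced by one built recursively:
-- only membership and the absence of repetitions have to be compared.
sameElements⇒↭ : ∀ {a} {A : Set a} {xs ys : List A} → Unique xs → Unique ys →
  (∀ x → x ∈ xs ⇔ x ∈ ys) → xs ↭ ys
sameElements⇒↭ xs! ys! same = ∼bag⇒↭ (unique∧set⇒bag xs! ys! (same _))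

map-disjoint : ∀ {a b c} {A : Set a} {B : Set b} {C : Set c} {f : A → C} {g : B → C} →
  (∀ x y → f x ≢ g y) → ∀ {xs ys} → Disjoint (List.map f xs) (List.map g ys)
map-disjoint f≢g (p , q) with ∈-map⁻ _ p | ∈-map⁻ _ q
... | x , _ , v≡fx | y , _ , v≡gy = f≢g x y (≡.trans (≡.sym v≡fx) v≡gy)

words : ℕ → ℕ → List (List ℤ)
words zero    zero    = [] ∷ []
words (suc a) zero    = List.map (+ 2 ∷_) (words a zero)
words zero    (suc b) = List.map (+ 1 ∷_) (words zero b)
words (suc a) (suc b) = List.map (+ 2 ∷_) (words a (suc b)) ++ List.map (+ 1 ∷_) (words (suc a) b)

words-unique : ∀ a b → Unique (words a b)
words-unique zero    zero    = [] ∷ []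
words-unique (suc a) zero    = Unique.map⁺ List.∷-injectiveʳ (words-unique a zero)
words-unique zero    (suc b) = Unique.map⁺ List.∷-injectiveʳ (words-unique zero b)
words-unique (suc a) (suc b) = Unique.++⁺
  (Unique.map⁺ List.∷-injectiveʳ (words-unique a (suc b)))
  (Unique.map⁺ List.∷-injectiveʳ (words-unique (suc a) b))
  (map-disjoint λ _ _ ())

-- Mediates between `words a b` and the permutations of `sorted a b`. The letter counts sit in the
-- indices, and exchanging two adjacent constructors preserves them, so the predicate travels along
-- any `↭`.
data Word : ℕ → ℕ → List ℤ → Set where
  []   : Word 0 0 []
  two∷ : ∀ {a b w} → Word a b w → Word (suc a) b (+ 2 ∷ w)
  one∷ : ∀ {a b w} → Word a b w → Word a (suc b) (+ 1 ∷ w)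

Word-resp-↭ : ∀ {a b v w} → v ↭ w → Word a b v → Word a b w
Word-resp-↭ ↭.refl         p               = p
Word-resp-↭ (prep _ r)     (two∷ p)        = two∷ (Word-resp-↭ r p)
Word-resp-↭ (prep _ r)     (one∷ p)        = one∷ (Word-resp-↭ r p)
Word-resp-↭ (swap _ _ r)   (two∷ (two∷ p)) = two∷ (two∷ (Word-resp-↭ r p))
Word-resp-↭ (swap _ _ r)   (two∷ (one∷ p)) = one∷ (two∷ (Word-resp-↭ r p))
Word-resp-↭ (swap _ _ r)   (one∷ (two∷ p)) = two∷ (one∷ (Word-resp-↭ r p))
Word-resp-↭ (swap _ _ r)   (one∷ (one∷ p)) = one∷ (one∷ (Word-resp-↭ r p))
Word-resp-↭ (↭.trans r r′) p               = Word-resp-↭ r′ (Word-resp-↭ r p)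

-- The trailing `++ []` is what `blocks` produces, so `𝒴ᵇ` of two blocks of natural lengths is
-- `𝒴 (sorted a b)` by computation.
sorted : ℕ → ℕ → List ℤ
sorted a b = replicate a (+ 2) ++ replicate b (+ 1) ++ []

Word-sorted : ∀ a b → Word a b (sorted a b)
Word-sorted zero    zero    = []
Word-sorted zero    (suc b) = one∷ (Word-sorted zero b)
Word-sorted (suc a) b       = two∷ (Word-sorted a b)

Word⇒↭ : ∀ {a b w} → Word a b w → w ↭ sorted a b
Word⇒↭ []           = ↭-refl
Word⇒↭ (two∷ p)     = prep _ (Word⇒↭ p)
Word⇒↭ {a} {suc b} (one∷ p) =
  ↭-trans (prep _ (Word⇒↭ p)) (↭-sym (shift (+ 1) (replicate a (+ 2)) (replicate b (+ 1) ++ [])))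

Word⇒∈ : ∀ {a b w} → Word a b w → w ∈ words a b
Word⇒∈ []                   = here ≡.refl
Word⇒∈ {b = zero}  (two∷ p) = ∈-map⁺ _ (Word⇒∈ p)
Word⇒∈ {b = suc b} (two∷ p) = ∈-++⁺ˡ (∈-map⁺ _ (Word⇒∈ p))
Word⇒∈ {a = zero}  (one∷ p) = ∈-map⁺ _ (Word⇒∈ p)
Word⇒∈ {a = suc a} (one∷ p) = ∈-++⁺ʳ _ (∈-map⁺ _ (Word⇒∈ p))

∈⇒Word : ∀ a b {w} → w ∈ words a b → Word a b w
∈⇒Word zero    zero    (here ≡.refl) = []
∈⇒Word (suc a) zero    p with ∈-map⁻ _ p
... | _ , q , ≡.refl = two∷ (∈⇒Word a zero q)
∈⇒Word zero    (suc b) p with ∈-map⁻ _ p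
... | _ , q , ≡.refl = one∷ (∈⇒Word zero b q)
∈⇒Word (suc a) (suc b) p with ∈-++⁻ (List.map (+ 2 ∷_) (words a (suc b))) p
... | inj₁ p′ with ∈-map⁻ _ p′
...   | _ , q , ≡.refl = two∷ (∈⇒Word a (suc b) q)
∈⇒Word (suc a) (suc b) p | inj₂ p′ with ∈-map⁻ _ p′
...   | _ , q , ≡.refl = one∷ (∈⇒Word (suc a) b q)

rearrangements↭words : ∀ a b → rearrangements (sorted a b) ↭ words a b
rearrangements↭words a b = sameElements⇒↭ (rearrangements-unique (sorted a b)) (words-unique a b)
  λ w → mk⇔
    (λ p → Word⇒∈ (Word-resp-↭ (↭-sym (Equivalence.to (∈-rearrangements (sorted a b) w) p)) (Word-sorted a b)))
    (λ p → Equivalence.from (∈-rearrangements (sorted a b) w) (Word⇒↭ (∈⇒Word a b p)))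

-- Increasing tuples of indices

-- The split is on whether index 0 occurs, in step with the recursion of `mono` on its first
-- variable.
increasing : ∀ N m → List (Vec (Fin N) m)
increasing N       zero    = [] ∷ []
increasing zero    (suc m) = []
increasing (suc N) (suc m) =
  List.map (λ v → Fin.zero ∷ Vec.map Fin.suc v) (increasing N m) ++ List.map (Vec.map Fin.suc) (increasing N (suc m))

map-suc-injective : ∀ {N m} {v w : Vec (Fin N) m} → Vec.map Fin.suc v ≡ Vec.map Fin.suc w → v ≡ w
map-suc-injective {v = []}    {[]}    _  = ≡.refl
map-suc-injective {v = _ ∷ _} {_ ∷ _} eq =
  ≡.cong₂ _∷_ (Fin.suc-injective (Vec.∷-injectiveˡ eq)) (map-suc-injective (Vec.∷-injectiveʳ eq))

increasing-unique : ∀ N m → Unique (increasing N m)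
increasing-unique N       zero    = [] ∷ []
increasing-unique zero    (suc m) = []
increasing-unique (suc N) (suc m) = Unique.++⁺
  (Unique.map⁺ (map-suc-injective ∘ Vec.∷-injectiveʳ) (increasing-unique N m))
  (Unique.map⁺ map-suc-injective (increasing-unique N (suc m)))
  (map-disjoint {g = Vec.map Fin.suc} λ { _ (_ ∷ _) () })

∈-increasing⁻ : ∀ N m {v} → v ∈ increasing N m → AllPairs Fin._<_ v
∈-increasing⁻ N       zero    (here ≡.refl) = []
∈-increasing⁻ (suc N) (suc m) p
  with ∈-++⁻ (List.map (λ v → Fin.zero ∷ Vec.map Fin.suc v) (increasing N m)) p
... | inj₁ p′ with ∈-map⁻ _ p′
...   | _ , q , ≡.refl =
  Allₚ.map⁺ (All.universal (λ _ → z<s) _) ∷ AllPairsₚ.map⁺ (AllPairs.map s<s (∈-increasing⁻ N m q))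
∈-increasing⁻ (suc N) (suc m) p | inj₂ p′ with ∈-map⁻ _ p′
...   | _ , q , ≡.refl = AllPairsₚ.map⁺ (AllPairs.map s<s (∈-increasing⁻ N (suc m) q))

lower : ∀ {N m} {i : Fin (suc N)} {v : Vec (Fin (suc N)) m} → All (i Fin.<_) v → ∃ λ w → v ≡ Vec.map suc w
lower []                  = [] , ≡.refl
lower {v = zero  ∷ _} (() ∷ _)
lower {v = suc j ∷ _} (_ ∷ i<) with lower i<
... | w , ≡.refl = j ∷ w , ≡.refl

AllPairs-suc⁻ : ∀ {N m} {v : Vec (Fin N) m} → AllPairs Fin._<_ (Vec.map suc v) → AllPairs Fin._<_ v
AllPairs-suc⁻ {v = []}    []       = []
AllPairs-suc⁻ {v = _ ∷ _} (i< ∷ p) = All.map ℕ.s<s⁻¹ (Allₚ.map⁻ i<) ∷ AllPairs-suc⁻ p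

∈-increasing⁺ : ∀ {N m} {v : Vec (Fin N) m} → AllPairs Fin._<_ v → v ∈ increasing N m
∈-increasing⁺ [] = here ≡.refl
∈-increasing⁺ {suc N} {suc m} {zero ∷ _} (0< ∷ p) with lower 0<
... | w , ≡.refl = ∈-++⁺ˡ (∈-map⁺ _ (∈-increasing⁺ (AllPairs-suc⁻ p)))
∈-increasing⁺ {suc N} {suc m} {suc i ∷ _} (i< ∷ p) with lower i<
... | w , ≡.refl = ∈-++⁺ʳ _ (∈-map⁺ _ (∈-increasing⁺ (AllPairs-suc⁻ {v = i ∷ w} (i< ∷ p))))

increasingTuples↭increasing : ∀ N m → increasingTuples N m ↭ increasing N m
increasingTuples↭increasing N m = sameElements⇒↭
  (Unique.filter⁺ (allPairs? Fin._<?_) (tuples-unique m)) (increasing-unique N m)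
  λ v → mk⇔
    (λ p → ∈-increasing⁺ (proj₂ (∈-filter⁻ (allPairs? Fin._<?_) {xs = tuples N m} p)))
    (λ p → ∈-filter⁺ (allPairs? Fin._<?_) (∈-tuples v) (∈-increasing⁻ N m p))
  where
  tuples-unique : ∀ m → Unique (tuples N m)
  tuples-unique zero    = [] ∷ []
  tuples-unique (suc m) =
    Unique.cartesianProductWith⁺ _∷_ Vec.∷-injective (Unique.allFin⁺ N) (tuples-unique m)
  ∈-tuples : ∀ {m} (v : Vec (Fin N) m) → v ∈ tuples N m
  ∈-tuples []      = here ≡.refl
  ∈-tuples (i ∷ v) = ∈-cartesianProductWith⁺ _∷_ (∈-allFin i) (∈-tuples v)

-- Nested sums as monomial symmetric functions

module ListSums {c ℓ₁ ℓ₂} (K : HeytingField c ℓ₁ ℓ₂) where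

  open FieldOps K using (commutativeRing; sumₗ)
  open CommutativeRing commutativeRing hiding (zero)
  open SymmetricSums commutativeSemiring using (mono)
  open SemiringSolver commutativeSemiring using (solve; _:=_; _:+_; _:*_; con)
  open SetoidReasoning setoid

  module _ {a} {A : Set a} where

    sumₗ-cong : ∀ {f g : A → Carrier} → (∀ x → f x ≈ g x) → ∀ xs → sumₗ xs f ≈ sumₗ xs g
    sumₗ-cong f≈g []       = refl
    sumₗ-cong f≈g (x ∷ xs) = +-cong (f≈g x) (sumₗ-cong f≈g xs)

    sumₗ-zero : ∀ {f : A → Carrier} → (∀ x → f x ≈ 0#) → ∀ xs → sumₗ xs f ≈ 0#
    sumₗ-zero f≈0 []       = refl
    sumₗ-zero f≈0 (x ∷ xs) = trans (+-cong (f≈0 x) (sumₗ-zero f≈0 xs)) (+-identityˡ _)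

    sumₗ-++ : ∀ (f : A → Carrier) xs ys → sumₗ (xs ++ ys) f ≈ sumₗ xs f + sumₗ ys f
    sumₗ-++ f []       ys = sym (+-identityˡ _)
    sumₗ-++ f (x ∷ xs) ys = trans (+-congˡ (sumₗ-++ f xs ys)) (sym (+-assoc _ _ _))

    sumₗ-+ : ∀ (f g : A → Carrier) xs → sumₗ xs (λ x → f x + g x) ≈ sumₗ xs f + sumₗ xs g
    sumₗ-+ f g []       = sym (+-identityˡ _)
    sumₗ-+ f g (x ∷ xs) = trans (+-congˡ (sumₗ-+ f g xs))
      (solve 4 (λ a b c d → a :+ b :+ (c :+ d) := (a :+ c) :+ (b :+ d)) refl _ _ _ _)

    sumₗ-* : ∀ x (f : A → Carrier) xs → sumₗ xs (λ a → x * f a) ≈ x * sumₗ xs f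
    sumₗ-* x f []       = sym (zeroʳ x)
    sumₗ-* x f (a ∷ as) = trans (+-congˡ (sumₗ-* x f as)) (sym (distribˡ _ _ _))

    sumₗ-map : ∀ {b} {B : Set b} (f : A → Carrier) (h : B → A) xs → sumₗ (List.map h xs) f ≡ sumₗ xs (f ∘ h)
    sumₗ-map f h []       = ≡.refl
    sumₗ-map f h (x ∷ xs) = ≡.cong (λ s → f (h x) + s) (sumₗ-map f h xs)

    sumₗ-↭ : ∀ (f : A → Carrier) {xs ys} → xs ↭ ys → sumₗ xs f ≈ sumₗ ys f
    sumₗ-↭ f ↭.refl         = refl
    sumₗ-↭ f (prep x p)     = +-congˡ (sumₗ-↭ f p)
    sumₗ-↭ f (swap x y p)   = trans (+-congˡ (+-congˡ (sumₗ-↭ f p)))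
      (solve 3 (λ x y z → x :+ (y :+ z) := y :+ (x :+ z)) refl _ _ _)
    sumₗ-↭ f (↭.trans p p′) = trans (sumₗ-↭ f p) (sumₗ-↭ f p′)

  -- `term` with arbitrary values `p i s` for the powers. Dropping the first index replaces `p` by
  -- `p ∘ suc`, which no longer has the form (1 - ζ^i)^(-s), so the induction runs over general `p`.
  weight : ∀ {N m} → (Fin N → ℤ → Carrier) → Vec ℤ m → Vec (Fin N) m → Carrier
  weight p []       []       = 1#
  weight p (s ∷ ss) (i ∷ is) = p i s * weight p ss is

  weight-suc : ∀ {N m} (p : Fin (suc N) → ℤ → Carrier) (ss : Vec ℤ m) is →
    weight p ss (Vec.map suc is) ≡ weight (p ∘ suc) ss is
  weight-suc p []       []       = ≡.refl
  weight-suc p (s ∷ ss) (i ∷ is) = ≡.cong (_ *_) (weight-suc p ss is)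

  -- 𝔷 with p i s in place of (1 - ζ^i)^(-s).
  iterated : ∀ {N} → (Fin N → ℤ → Carrier) → List ℤ → Carrier
  iterated {N}     p []       = 1#
  iterated {zero}  p (s ∷ ss) = 0#
  iterated {suc N} p (s ∷ ss) = p zero s * iterated (p ∘ suc) ss + iterated (p ∘ suc) (s ∷ ss)

  sum-increasing : ∀ {N} (p : Fin N → ℤ → Carrier) s →
    sumₗ (increasing N (length s)) (weight p (Vec.fromList s)) ≈ iterated p s
  sum-increasing {N}     p []       = +-identityʳ 1#
  sum-increasing {zero}  p (s ∷ ss) = refl
  sum-increasing {suc N} p (s ∷ ss) = begin
    sumₗ (List.map cons₀ with₀ ++ List.map (Vec.map suc) without₀) w
      ≈⟨ sumₗ-++ w (List.map cons₀ with₀) _ ⟩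
    sumₗ (List.map cons₀ with₀) w + sumₗ (List.map (Vec.map suc) without₀) w
      ≡⟨ ≡.cong₂ _+_ (sumₗ-map w cons₀ with₀) (sumₗ-map w (Vec.map suc) without₀) ⟩
    sumₗ with₀ (w ∘ cons₀) + sumₗ without₀ (w ∘ Vec.map suc)
      ≈⟨ +-cong
           (trans (sumₗ-cong (λ is → *-congˡ (reflexive (weight-suc p (Vec.fromList ss) is))) with₀)
                  (sumₗ-* (p zero s) (weight (p ∘ suc) (Vec.fromList ss)) with₀))
           (sumₗ-cong (λ is → reflexive (weight-suc p (Vec.fromList (s ∷ ss)) is)) without₀) ⟩
    p zero s * sumₗ with₀ (weight (p ∘ suc) (Vec.fromList ss))
      + sumₗ without₀ (weight (p ∘ suc) (Vec.fromList (s ∷ ss)))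
      ≈⟨ +-cong (*-congˡ (sum-increasing (p ∘ suc) ss)) (sum-increasing (p ∘ suc) (s ∷ ss)) ⟩
    iterated p (s ∷ ss) ∎
    where
    with₀ : List (Vec (Fin N) (length ss))
    with₀ = increasing N (length ss)
    without₀ : List (Vec (Fin N) (suc (length ss)))
    without₀ = increasing N (suc (length ss))
    w : Vec (Fin (suc N)) (suc (length ss)) → Carrier
    w = weight p (Vec.fromList (s ∷ ss))
    cons₀ : Vec (Fin N) (length ss) → Vec (Fin (suc N)) (suc (length ss))
    cons₀ v = zero ∷ Vec.map suc v

  -- The first variable either takes the leading letter `s` or is skipped. The skipped part is kept
  -- as a sum over words starting with `s`, ready to be merged with the words starting with the
  -- other letter.
  sum-cons : ∀ {N} (p : Fin (suc N) → ℤ → Carrier) s ws →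
    sumₗ (List.map (s ∷_) ws) (iterated p)
    ≈ p zero s * sumₗ ws (iterated (p ∘ suc)) + sumₗ (List.map (s ∷_) ws) (iterated (p ∘ suc))
  sum-cons p s ws = begin
    sumₗ (List.map (s ∷_) ws) (iterated p)
      ≡⟨ sumₗ-map (iterated p) (s ∷_) ws ⟩
    sumₗ ws (λ w → p zero s * iterated (p ∘ suc) w + iterated (p ∘ suc) (s ∷ w))
      ≈⟨ sumₗ-+ _ _ ws ⟩
    sumₗ ws (λ w → p zero s * iterated (p ∘ suc) w) + sumₗ ws (iterated (p ∘ suc) ∘ (s ∷_))
      ≈⟨ +-cong (sumₗ-* (p zero s) _ ws) (reflexive (≡.sym (sumₗ-map (iterated (p ∘ suc)) (s ∷_) ws))) ⟩
    p zero s * sumₗ ws (iterated (p ∘ suc)) + sumₗ (List.map (s ∷_) ws) (iterated (p ∘ suc)) ∎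

  -- The first variable takes a leading 2, takes a leading 1, or is skipped: these are the three
  -- summands of `mono`, and the skipped parts of both kinds reassemble to `words a b`.
  sum-words : ∀ {N} (p : Fin N → ℤ → Carrier) (y : Fin N → Carrier) →
    (∀ i → p i (+ 1) ≈ y i) → (∀ i → p i (+ 2) ≈ y i * y i) →
    ∀ a b → sumₗ (words a b) (iterated p) ≈ mono y a b
  sum-words {zero} p y p₁ p₂ = empty
    where
    cons-zero : ∀ s ws → sumₗ (List.map (s ∷_) ws) (iterated p) ≈ 0#
    cons-zero s ws = trans (reflexive (sumₗ-map (iterated p) (s ∷_) ws)) (sumₗ-zero (λ _ → refl) ws)
    empty : ∀ a b → sumₗ (words a b) (iterated p) ≈ mono y a b
    empty zero    zero    = +-identityʳ 1#
    empty zero    (suc b) = cons-zero (+ 1) (words zero b)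
    empty (suc a) zero    = cons-zero (+ 2) (words a zero)
    empty (suc a) (suc b) = trans (sumₗ-++ (iterated p) (List.map (+ 2 ∷_) (words a (suc b))) _)
      (trans (+-cong (cons-zero (+ 2) (words a (suc b))) (cons-zero (+ 1) (words (suc a) b))) (+-identityˡ 0#))
  sum-words {suc N} p y p₁ p₂ = step
    where
    p′ : Fin N → ℤ → Carrier
    p′ = p ∘ suc
    y′ : Fin N → Carrier
    y′ = y ∘ suc
    x : Carrier
    x = y zero
    S : List (List ℤ) → Carrier
    S ws = sumₗ ws (iterated p)
    S′ : List (List ℤ) → Carrier
    S′ ws = sumₗ ws (iterated p′)
    IH : ∀ a b → S′ (words a b) ≈ mono y′ a b
    IH = sum-words p′ y′ (p₁ ∘ suc) (p₂ ∘ suc)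
    one : ∀ a b → S (List.map (+ 1 ∷_) (words a b)) ≈ x * mono y′ a b + S′ (List.map (+ 1 ∷_) (words a b))
    one a b = trans (sum-cons p (+ 1) (words a b)) (+-congʳ (*-cong (p₁ zero) (IH a b)))
    two : ∀ a b → S (List.map (+ 2 ∷_) (words a b)) ≈ x * x * mono y′ a b + S′ (List.map (+ 2 ∷_) (words a b))
    two a b = trans (sum-cons p (+ 2) (words a b)) (+-congʳ (*-cong (p₂ zero) (IH a b)))
    step : ∀ a b → S (words a b) ≈ mono y a b
    step zero zero = trans (IH zero zero)
      (solve 2 (λ m x → m := m :+ (x :* con 0 :+ x :* x :* con 0)) refl _ _)
    step zero (suc b) = trans (one zero b) (trans (+-congˡ (IH zero (suc b)))
      (solve 3 (λ x m o → x :* o :+ m := m :+ (x :* o :+ x :* x :* con 0)) refl _ _ _))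
    step (suc a) zero = trans (two a zero) (trans (+-congˡ (IH (suc a) zero))
      (solve 3 (λ x m t → x :* x :* t :+ m := m :+ (x :* con 0 :+ x :* x :* t)) refl _ _ _))
    step (suc a) (suc b) = begin
      S (List.map (+ 2 ∷_) (words a (suc b)) ++ List.map (+ 1 ∷_) (words (suc a) b))
        ≈⟨ sumₗ-++ (iterated p) (List.map (+ 2 ∷_) (words a (suc b))) _ ⟩
      S (List.map (+ 2 ∷_) (words a (suc b))) + S (List.map (+ 1 ∷_) (words (suc a) b))
        ≈⟨ +-cong (two a (suc b)) (one (suc a) b) ⟩
      x * x * mono y′ a (suc b) + S′ (List.map (+ 2 ∷_) (words a (suc b)))
        + (x * mono y′ (suc a) b + S′ (List.map (+ 1 ∷_) (words (suc a) b)))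
        ≈⟨ solve 5 (λ x t s o s′ → x :* x :* t :+ s :+ (x :* o :+ s′)
             := (s :+ s′) :+ (x :* o :+ x :* x :* t)) refl _ _ _ _ _ ⟩
      S′ (List.map (+ 2 ∷_) (words a (suc b))) + S′ (List.map (+ 1 ∷_) (words (suc a) b))
        + (x * mono y′ (suc a) b + x * x * mono y′ a (suc b))
        ≈⟨ +-congʳ (trans (sym (sumₗ-++ (iterated p′) (List.map (+ 2 ∷_) (words a (suc b))) _)) (IH (suc a) (suc b))) ⟩
      mono y (suc a) (suc b) ∎

-- The numbers 1/(1 - ζ^i) and their elementary symmetric functions

module Cyclotomic {c ℓ₁ ℓ₂} (K : HeytingField c ℓ₁ ℓ₂) (char0 : FieldOps.CharacteristicZero K)
  (N : ℕ) (ζ : HeytingField.Carrier K) (prim : FieldOps.IsPrimitiveRoot K (suc N) ζ) where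

  open HeytingField K using (#⇒invertible)
  open FieldOps K using (commutativeRing; IsPrimitiveRoot; _^_; fromℕ; _^ᶻ_)
  open CyclotomicSums K char0 (suc N) ζ prim using (𝒴; 𝔷; term; index; 1-ζ^_)
  open IsPrimitiveRoot prim
  open CommutativeRing commutativeRing hiding (zero)
  open RingProperties ring
  open Exp commutativeSemiring hiding (_^_)
  open SymmetricSums commutativeSemiring using (e; mono)
  open SetoidReasoning setoid
  open ListSums K
  open Roots commutativeRing
  open SemiringSolver commutativeSemiring using (solve; _:=_; _:*_)

  y : Fin N → Carrier
  y i = proj₁ (1-ζ^ i)

  y-inverse : ∀ i → y i * (1# - ζ ^ index i) ≈ 1#
  y-inverse i = proj₁ (proj₂ (1-ζ^ i))

  power : Fin N → ℤ → Carrier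
  power i s = (1-ζ^ i) ^ᶻ (ℤ.- s)

  term-weight : ∀ {m} (ss : Vec ℤ m) is → term ss is ≡ weight power ss is
  term-weight []       []       = ≡.refl
  term-weight (s ∷ ss) (i ∷ is) = ≡.cong (_ *_) (term-weight ss is)

  𝔷-iterated : ∀ s → 𝔷 s ≈ iterated power s
  𝔷-iterated s = trans (sumₗ-↭ _ (increasingTuples↭increasing N (length s)))
    (trans (sumₗ-cong (λ is → reflexive (term-weight (Vec.fromList s) is)) (increasing N (length s)))
           (sum-increasing power s))

  𝒴-mono : ∀ a b → 𝒴 (sorted a b) ≈ mono y a b
  𝒴-mono a b = trans (sumₗ-cong 𝔷-iterated (rearrangements (sorted a b)))
    (trans (sumₗ-↭ (iterated power) (rearrangements↭words a b))
      (sum-words power y (λ i → *-identityʳ _) (λ i → *-congˡ (*-identityʳ _)) a b))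

  invertible⇒cancellable : ∀ {x} → Invertible _≈_ 1# _*_ x → Cancellable x
  invertible⇒cancellable {x} (x⁻¹ , x⁻¹x≈1 , _) {z} xz≈0 = begin
    z              ≈⟨ sym (*-identityˡ z) ⟩
    1# * z         ≈⟨ *-congʳ (sym x⁻¹x≈1) ⟩
    x⁻¹ * x * z    ≈⟨ *-assoc _ _ _ ⟩
    x⁻¹ * (x * z)  ≈⟨ *-congˡ xz≈0 ⟩
    x⁻¹ * 0#       ≈⟨ zeroʳ _ ⟩
    0#             ∎

  difference-zero : ∀ {a b} z → (a - b) * z ≈ 0# → a * z ≈ b * z
  difference-zero {a} {b} z eq = x∙y⁻¹≈ε⇒x≈y (a * z) (b * z)
    (trans (+-congˡ (-‿distribˡ-* b z)) (trans (sym (distribʳ z a (- b))) eq))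

  -- Multiplying `s * z ≈ t * z` by `(1# - u) * (1# - v)` leaves `(1# - v) * z ≈ (1# - u) * z`. The
  -- factor `z` is carried along because cancellability is the goal.
  reciprocal : ∀ {u v s t} z → s * (1# - u) ≈ 1# → t * (1# - v) ≈ 1# → s * z ≈ t * z → u * z ≈ v * z
  reciprocal {u} {v} {s} {t} z su tv sz≈tz = -‿injective (+-cancelˡ z _ _ (begin
    z - u * z            ≈⟨ complement u ⟩
    (1# - u) * z         ≈⟨ sym (*-identityˡ _) ⟩
    1# * ((1# - u) * z)  ≈⟨ *-congʳ (sym tv) ⟩
    t * (1# - v) * ((1# - u) * z)
      ≈⟨ solve 4 (λ t v u z → t :* v :* (u :* z) := v :* u :* (t :* z)) refl _ _ _ _ ⟩
    (1# - v) * (1# - u) * (t * z)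
      ≈⟨ *-congˡ (sym sz≈tz) ⟩
    (1# - v) * (1# - u) * (s * z)
      ≈⟨ solve 4 (λ s v u z → v :* u :* (s :* z) := s :* u :* (v :* z)) refl _ _ _ _ ⟩
    s * (1# - u) * ((1# - v) * z)  ≈⟨ *-congʳ su ⟩
    1# * ((1# - v) * z)  ≈⟨ *-identityˡ _ ⟩
    (1# - v) * z         ≈⟨ sym (complement v) ⟩
    z - v * z            ∎))
    where
    complement : ∀ u → z - u * z ≈ (1# - u) * z
    complement u = sym (trans (distribʳ z 1# (- u)) (+-cong (*-identityˡ z) (sym (-‿distribˡ-* u z))))

  -- If `y i` and `y j` agree on `z`, so do `ζ ^ index i` and `ζ ^ index j`; hence `ζ ^ d` fixes `z`
  -- for the difference `d` of the indices. As `0 < d < n`, primitivity makes `ζ ^ d - 1#`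
  -- invertible, and `z` is 0.
  y-distinct : ∀ i j → i Fin.< j → Cancellable (y i - y j)
  y-distinct i j i<j {z} eq = invertible⇒cancellable (#⇒invertible (ζ^k#1 d 0<d d<n)) (begin
    (ζ ^ d - 1#) * z              ≈⟨ distribʳ z (ζ ^ d) (- 1#) ⟩
    ζ ^ d * z + - 1# * z          ≈⟨ +-cong ζ^d-fixes (-1*x≈-x z) ⟩
    z - z                         ≈⟨ -‿inverseʳ z ⟩
    0#                            ∎)
    where
    d b : ℕ
    d = index j ∸ index i
    -- Chosen so that `ζ ^ b` is inverse to `ζ ^ index i`.
    b = suc N ∸ index i
    0<d : 0 < d
    0<d = ℕ.m<n⇒0<n∸m i<j
    d<n : d < suc N
    d<n = s≤s (ℕ.≤-trans (ℕ.m∸n≤m (toℕ j) (toℕ i)) (ℕ.<⇒≤ (Fin.toℕ<n j)))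
    same : ζ ^ index i * z ≈ ζ ^ index j * z
    same = reciprocal z (y-inverse i) (y-inverse j) (difference-zero z eq)
    cycle : ∀ z → ζ ^ b * (ζ ^ index i * z) ≈ z
    cycle z = begin
      ζ ^ b * (ζ ^ index i * z)  ≈⟨ sym (*-assoc _ _ _) ⟩
      ζ ^ b * ζ ^ index i * z    ≈⟨ *-congʳ (sym (^-homo-* ζ b (index i))) ⟩
      ζ ^ (b ℕ.+ index i) * z
        ≡⟨ ≡.cong (λ k → ζ ^ k * z) (ℕ.m∸n+n≡m (ℕ.m≤n⇒m≤1+n (Fin.toℕ<n i))) ⟩
      ζ ^ suc N * z              ≈⟨ *-congʳ ζ^n≈1 ⟩
      1# * z                     ≈⟨ *-identityˡ z ⟩
      z                          ∎
    ζ^d-fixes : ζ ^ d * z ≈ z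
    ζ^d-fixes = begin
      ζ ^ d * z                              ≈⟨ sym (cycle _) ⟩
      ζ ^ b * (ζ ^ index i * (ζ ^ d * z))    ≈⟨ *-congˡ (sym (*-assoc _ _ _)) ⟩
      ζ ^ b * (ζ ^ index i * ζ ^ d * z)      ≈⟨ *-congˡ (*-congʳ (sym (^-homo-* ζ (index i) d))) ⟩
      ζ ^ b * (ζ ^ (index i ℕ.+ d) * z)
        ≡⟨ ≡.cong (λ k → ζ ^ b * (ζ ^ k * z)) (ℕ.m+[n∸m]≡n (ℕ.<⇒≤ (s<s i<j))) ⟩
      ζ ^ b * (ζ ^ index j * z)              ≈⟨ *-congˡ (sym same) ⟩
      ζ ^ b * (ζ ^ index i * z)              ≈⟨ cycle z ⟩
      z                                      ∎

  1^n≈1 : ∀ n → 1# ^ n ≈ 1#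
  1^n≈1 zero    = refl
  1^n≈1 (suc n) = trans (*-identityˡ _) (1^n≈1 n)

  y-root : ∀ i → (- y i + 1#) ^ suc N ≈ (- y i) ^ suc N
  y-root i = begin
    (- y i + 1#) ^ suc N              ≈⟨ ^-congˡ (suc N) shifted ⟩
    (u * - y i) ^ suc N               ≈⟨ ^-distrib-* u (- y i) (suc N) ⟩
    u ^ suc N * (- y i) ^ suc N       ≈⟨ *-congʳ u^n≈1 ⟩
    1# * (- y i) ^ suc N              ≈⟨ *-identityˡ _ ⟩
    (- y i) ^ suc N                   ∎
    where
    u : Carrier
    u = ζ ^ index i
    shifted : - y i + 1# ≈ u * - y i
    shifted = begin
      - y i + 1#                       ≈⟨ +-congˡ (sym (y-inverse i)) ⟩
      - y i + y i * (1# - u)           ≈⟨ +-congˡ (distribˡ (y i) 1# (- u)) ⟩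
      - y i + (y i * 1# + y i * - u)   ≈⟨ sym (+-assoc _ _ _) ⟩
      - y i + y i * 1# + y i * - u     ≈⟨ +-congʳ (trans (+-congˡ (*-identityʳ (y i))) (-‿inverseˡ (y i))) ⟩
      0# + y i * - u                   ≈⟨ +-identityˡ _ ⟩
      y i * - u                        ≈⟨ sym (-‿distribʳ-* (y i) u) ⟩
      - (y i * u)                      ≈⟨ -‿cong (*-comm (y i) u) ⟩
      - (u * y i)                      ≈⟨ -‿distribʳ-* u (y i) ⟩
      u * - y i                        ∎
    u^n≈1 : u ^ suc N ≈ 1#
    u^n≈1 = begin
      (ζ ^ index i) ^ suc N     ≈⟨ ^-assocʳ ζ (index i) (suc N) ⟩
      ζ ^ (index i ℕ.* suc N)   ≡⟨ ≡.cong (ζ ^_) (ℕ.*-comm (index i) (suc N)) ⟩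
      ζ ^ (suc N ℕ.* index i)   ≈⟨ sym (^-assocʳ ζ (suc N) (index i)) ⟩
      (ζ ^ suc N) ^ index i     ≈⟨ ^-congˡ (index i) ζ^n≈1 ⟩
      1# ^ index i              ≈⟨ 1^n≈1 (index i) ⟩
      1#                        ∎

  n*e : ∀ k → k ≤ N → fromℕ (suc N) * e y k ≈ fromℕ (suc N C suc k)
  -- The factor `n` is the leading coefficient `suc N C 1` in `vieta`.
  n*e k k≤N = sym (trans
    (vieta (fromℕ ∘ (suc N C_) ∘ suc) y y-distinct (λ i → horner-difference N (- y i) (y-root i)) k k≤N)
    (*-congʳ (reflexive (≡.cong fromℕ (nC1≡n (suc N))))))

-- Identities between binomial coefficients

C-factorial : ∀ a b → ((a ℕ.+ b) C a) ℕ.* (a ! ℕ.* b !) ≡ (a ℕ.+ b) !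
C-factorial a b = begin
  ((a ℕ.+ b) C a) ℕ.* (a ! ℕ.* b !)
    ≡⟨ ≡.cong (λ c → ((a ℕ.+ b) C a) ℕ.* (a ! ℕ.* c !)) (≡.sym (ℕ.m+n∸m≡n a b)) ⟩
  ((a ℕ.+ b) C a) ℕ.* (a ! ℕ.* (a ℕ.+ b ∸ a) !)
    ≡⟨ ≡.cong (ℕ._* (a ! ℕ.* (a ℕ.+ b ∸ a) !)) (nCk≡n!/k![n-k]! (ℕ.m≤m+n a b)) ⟩
  _ ≡⟨ m/n*n≡m (k![n∸k]!∣n! (ℕ.m≤m+n a b)) ⟩
  (a ℕ.+ b) ! ∎
  where
  open ≡.≡-Reasoning
  instance _ = a ℕ.!* (a ℕ.+ b ∸ a) !≢0

C-symmetric : ∀ a b → (a ℕ.+ b) C a ≡ (a ℕ.+ b) C b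
C-symmetric a b = ≡.trans (nCk≡nC[n∸k] (ℕ.m≤m+n a b)) (≡.cong ((a ℕ.+ b) C_) (ℕ.m+n∸m≡n a b))

-- Both sides are the multinomial coefficient (a+b+c)!/(a! b! c!).
C-trinomial : ∀ a b c →
  ((b ℕ.+ a ℕ.+ c) C b) ℕ.* ((a ℕ.+ c) C a) ≡ ((b ℕ.+ a ℕ.+ c) C (b ℕ.+ a)) ℕ.* ((b ℕ.+ a) C a)
C-trinomial a b c = ℕ.*-cancelʳ-≡ _ _ (a ! ℕ.* b ! ℕ.* c !) (≡.trans lhs (≡.sym rhs))
  where
  open ≡.≡-Reasoning
  instance _ = ℕ.m*n≢0 (a ! ℕ.* b !) (c !) {{a ℕ.!* b !≢0}} {{c ℕ.!≢0}}
  lhs : ((b ℕ.+ a ℕ.+ c) C b) ℕ.* ((a ℕ.+ c) C a) ℕ.* (a ! ℕ.* b ! ℕ.* c !) ≡ (b ℕ.+ a ℕ.+ c) !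
  lhs = begin
    ((b ℕ.+ a ℕ.+ c) C b) ℕ.* ((a ℕ.+ c) C a) ℕ.* (a ! ℕ.* b ! ℕ.* c !)
      ≡⟨ rearrange ((b ℕ.+ a ℕ.+ c) C b) ((a ℕ.+ c) C a) (a !) (b !) (c !) ⟩
    ((b ℕ.+ a ℕ.+ c) C b) ℕ.* (b ! ℕ.* (((a ℕ.+ c) C a) ℕ.* (a ! ℕ.* c !)))
      ≡⟨ ≡.cong₂ (λ n d → (n C b) ℕ.* (b ! ℕ.* d)) (ℕ.+-assoc b a c) (C-factorial a c) ⟩
    ((b ℕ.+ (a ℕ.+ c)) C b) ℕ.* (b ! ℕ.* (a ℕ.+ c) !)
      ≡⟨ C-factorial b (a ℕ.+ c) ⟩
    (b ℕ.+ (a ℕ.+ c)) !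
      ≡⟨ ≡.cong _! (≡.sym (ℕ.+-assoc b a c)) ⟩
    (b ℕ.+ a ℕ.+ c) ! ∎
    where
    rearrange : ∀ x y a b c → x ℕ.* y ℕ.* (a ℕ.* b ℕ.* c) ≡ x ℕ.* (b ℕ.* (y ℕ.* (a ℕ.* c)))
    rearrange = ℕSolver.solve-∀
  rhs : ((b ℕ.+ a ℕ.+ c) C (b ℕ.+ a)) ℕ.* ((b ℕ.+ a) C a) ℕ.* (a ! ℕ.* b ! ℕ.* c !) ≡ (b ℕ.+ a ℕ.+ c) !
  rhs = begin
    ((b ℕ.+ a ℕ.+ c) C (b ℕ.+ a)) ℕ.* ((b ℕ.+ a) C a) ℕ.* (a ! ℕ.* b ! ℕ.* c !)
      ≡⟨ rearrange ((b ℕ.+ a ℕ.+ c) C (b ℕ.+ a)) ((b ℕ.+ a) C a) (a !) (b !) (c !) ⟩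
    ((b ℕ.+ a ℕ.+ c) C (b ℕ.+ a)) ℕ.* (((b ℕ.+ a) C a) ℕ.* (b ! ℕ.* a !) ℕ.* c !)
      ≡⟨ ≡.cong (λ d → ((b ℕ.+ a ℕ.+ c) C (b ℕ.+ a)) ℕ.* (d ℕ.* c !))
           (≡.trans (≡.cong (ℕ._* (b ! ℕ.* a !)) (≡.sym (C-symmetric b a))) (C-factorial b a)) ⟩
    ((b ℕ.+ a ℕ.+ c) C (b ℕ.+ a)) ℕ.* ((b ℕ.+ a) ! ℕ.* c !)
      ≡⟨ C-factorial (b ℕ.+ a) c ⟩
    (b ℕ.+ a ℕ.+ c) ! ∎
    where
    rearrange : ∀ x y a b c → x ℕ.* y ℕ.* (a ℕ.* b ℕ.* c) ≡ x ℕ.* (y ℕ.* (b ℕ.* a) ℕ.* c)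
    rearrange = ℕSolver.solve-∀

-- Multiplied by `m ! * r !`, both sides become (m+r+1)!.
C-absorb : ∀ m r → (suc (m ℕ.+ r) C suc m) ℕ.* suc m ≡ suc (m ℕ.+ r) ℕ.* ((m ℕ.+ r) C m)
C-absorb m r = ℕ.*-cancelʳ-≡ _ _ (m ! ℕ.* r !) (begin
  (suc (m ℕ.+ r) C suc m) ℕ.* suc m ℕ.* (m ! ℕ.* r !)
    ≡⟨ rearrange (suc (m ℕ.+ r) C suc m) (suc m) (m !) (r !) ⟩
  (suc (m ℕ.+ r) C suc m) ℕ.* (suc m ! ℕ.* r !)
    ≡⟨ C-factorial (suc m) r ⟩
  suc (m ℕ.+ r) ℕ.* (m ℕ.+ r) !
    ≡⟨ ≡.cong (suc (m ℕ.+ r) ℕ.*_) (≡.sym (C-factorial m r)) ⟩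
  suc (m ℕ.+ r) ℕ.* (((m ℕ.+ r) C m) ℕ.* (m ! ℕ.* r !))
    ≡⟨ ≡.sym (ℕ.*-assoc (suc (m ℕ.+ r)) ((m ℕ.+ r) C m) (m ! ℕ.* r !)) ⟩
  suc (m ℕ.+ r) ℕ.* ((m ℕ.+ r) C m) ℕ.* (m ! ℕ.* r !) ∎)
  where
  open ≡.≡-Reasoning
  instance _ = m ℕ.!* r !≢0
  rearrange : ∀ x s a b → x ℕ.* s ℕ.* (a ℕ.* b) ≡ x ℕ.* (s ℕ.* a ℕ.* b)
  rearrange = ℕSolver.solve-∀

-- Evaluation of the sum from two products

module Expansion {c ℓ₁ ℓ₂} (K : HeytingField c ℓ₁ ℓ₂) (char0 : FieldOps.CharacteristicZero K)
  (k ℓ r : ℕ) (ζ : HeytingField.Carrier K) (prim : FieldOps.IsPrimitiveRoot K (suc (k ℕ.+ ℓ ℕ.+ r)) ζ) where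

  private
    m N n : ℕ
    m = k ℕ.+ ℓ
    N = m ℕ.+ r
    n = suc N

  open FieldOps K using (commutativeRing; fromℕ; fromℤ; sum)
  open CommutativeRing commutativeRing hiding (zero)
  open CyclotomicSums K char0 n ζ prim using (1/_; 𝒴; 𝒴ᵇ)
  open HeytingField K using (#⇒invertible)
  open Cyclotomic K char0 N ζ prim
  open RingProperties ring
  open Mult semiring using (×1-homo-*)
  open SymmetricSums commutativeSemiring
    using (e; mono; expand; e-product; expand-skip; expand-zeroʳ; mono-large; sum-expand)
  open SetoidReasoning setoid
  open SemiringSolver commutativeSemiring using (solve; _:=_; _:+_; _:*_)

  -- The terms of e_m e_(k+r) with more than `k` squares. Since n - m + ℓ - 3 - 2j = ℓ + r - 2 - 2j,
  -- the arguments `ℓ` and `r` of `expand` yield precisely the binomials of the theorem.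
  tail : Carrier
  tail = expand (λ a b → mono y (k ℕ.+ suc a) b) ℓ r

  1/-inverse : ∀ j .{{_ : NonZero j}} → 1/ j * fromℕ j ≈ 1#
  1/-inverse j = trans
    (*-congˡ (sym (trans (+-congˡ -0#≈0#) (+-identityʳ _))))
    (proj₁ (proj₂ (#⇒invertible (char0 j))))

  -- Terms of e_m e_(k+r) with fewer than k squares involve more than N variables.
  product : e y m * e y (k ℕ.+ r)
            ≈ fromℕ ((ℓ ℕ.+ r) C ℓ) * mono y (k ℕ.+ 0) (ℓ ℕ.+ r) + tail
  product = trans (e-product y m (k ℕ.+ r)) (expand-skip (mono y) k ℓ r (mono-large y))

  -- The first factor is the product of all `N` variables, so the second can only square `k` of
  -- them. Formally this is `expand-skip` with `q = 0`, whence the spelling `k + 0`, and a single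
  -- term with coefficient 1 is left.
  product-full : e y (k ℕ.+ (ℓ ℕ.+ r)) * e y (k ℕ.+ 0) ≈ mono y (k ℕ.+ 0) (ℓ ℕ.+ r)
  product-full = begin
    e y (k ℕ.+ (ℓ ℕ.+ r)) * e y (k ℕ.+ 0)
      ≈⟨ trans (e-product y _ _) (expand-skip (mono y) k (ℓ ℕ.+ r) 0
           (λ a b large → mono-large y a b (≡.subst (_< a ℕ.+ b)
             (≡.trans (ℕ.+-identityʳ _) (≡.sym (ℕ.+-assoc k ℓ r))) large))) ⟩
    fromℕ ((ℓ ℕ.+ r ℕ.+ 0) C (ℓ ℕ.+ r)) * mono y (k ℕ.+ 0) (ℓ ℕ.+ r ℕ.+ 0) + expand _ (ℓ ℕ.+ r) 0
      ≈⟨ trans (+-congˡ (expand-zeroʳ _ (ℓ ℕ.+ r))) (+-identityʳ _) ⟩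
    fromℕ ((ℓ ℕ.+ r ℕ.+ 0) C (ℓ ℕ.+ r)) * mono y (k ℕ.+ 0) (ℓ ℕ.+ r ℕ.+ 0)
      ≡⟨ ≡.cong (λ s → fromℕ (s C (ℓ ℕ.+ r)) * mono y (k ℕ.+ 0) s) (ℕ.+-identityʳ (ℓ ℕ.+ r)) ⟩
    fromℕ ((ℓ ℕ.+ r) C (ℓ ℕ.+ r)) * mono y (k ℕ.+ 0) (ℓ ℕ.+ r)
      ≈⟨ *-congʳ (trans (reflexive (≡.cong fromℕ (nCn≡1 (ℓ ℕ.+ r)))) (+-identityʳ 1#)) ⟩
    1# * mono y (k ℕ.+ 0) (ℓ ℕ.+ r)
      ≈⟨ *-identityˡ _ ⟩
    mono y (k ℕ.+ 0) (ℓ ℕ.+ r) ∎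

  n*e-m : fromℕ n * e y m ≈ fromℕ (n C suc m)
  n*e-m = n*e m (ℕ.m≤m+n m r)

  -- `k + r + 1` and `ℓ` add up to `n`; this is the source of `n C ℓ` in the theorem.
  n*e-k+r : fromℕ n * e y (k ℕ.+ r) ≈ fromℕ (n C ℓ)
  n*e-k+r = trans (n*e (k ℕ.+ r) (ℕ.+-monoˡ-≤ r (ℕ.m≤m+n k ℓ)))
    (reflexive (≡.cong fromℕ (≡.subst (λ n → n C suc (k ℕ.+ r) ≡ n C ℓ) (regroup k ℓ r)
      (≡.sym (C-symmetric ℓ (suc (k ℕ.+ r)))))))
    where
    regroup : ∀ k ℓ r → ℓ ℕ.+ suc (k ℕ.+ r) ≡ suc (k ℕ.+ ℓ ℕ.+ r)
    regroup = ℕSolver.solve-∀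

  n*e-k : fromℕ n * e y (k ℕ.+ 0) ≈ fromℕ (n C suc k)
  n*e-k = trans (*-congˡ (reflexive (≡.cong (e y) (ℕ.+-identityʳ k))))
    (n*e k (ℕ.≤-trans (ℕ.m≤m+n k ℓ) (ℕ.m≤m+n m r)))

  n*e-N : fromℕ n * e y (k ℕ.+ (ℓ ℕ.+ r)) ≈ 1#
  n*e-N = begin
    fromℕ n * e y (k ℕ.+ (ℓ ℕ.+ r))  ≡⟨ ≡.cong (λ s → fromℕ n * e y s) (≡.sym (ℕ.+-assoc k ℓ r)) ⟩
    fromℕ n * e y N                  ≈⟨ n*e N ℕ.≤-refl ⟩
    fromℕ (n C n)                    ≡⟨ ≡.cong fromℕ (nCn≡1 n) ⟩
    fromℕ 1                          ≈⟨ +-identityʳ 1# ⟩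
    1#                               ∎

  -- `C-trinomial` rewrites the contribution of the term with exactly `k` squares so that it shares
  -- the factor `n C suc m` with the full product. Keeping it as a summand on the left leaves the
  -- identity within reach of the semiring solver.
  tail-scaled : fromℕ n * fromℕ n * tail + fromℕ (n C suc m) * fromℕ (suc m C ℓ)
                ≈ fromℕ (n C suc m) * fromℕ (n C ℓ)
  tail-scaled = begin
    ν * ν * tail + fromℕ (n C suc m) * fromℕ (suc m C ℓ)
      ≈⟨ +-congˡ (sym (×1-homo-* (n C suc m) (suc m C ℓ))) ⟩
    ν * ν * tail + fromℕ ((n C suc m) ℕ.* (suc m C ℓ))
      ≡⟨ ≡.cong (λ s → ν * ν * tail + fromℕ s) (≡.sym (C-trinomial ℓ (suc k) r)) ⟩
    ν * ν * tail + fromℕ ((n C suc k) ℕ.* ((ℓ ℕ.+ r) C ℓ))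
      ≈⟨ +-congˡ (×1-homo-* (n C suc k) ((ℓ ℕ.+ r) C ℓ)) ⟩
    ν * ν * tail + fromℕ (n C suc k) * B
      -- The second factor `n` is supplied by writing 1 as `n` times e_N.
      ≈⟨ +-congˡ (*-congʳ (trans (sym (*-identityˡ _)) (*-cong (sym n*e-N) (sym n*e-k)))) ⟩
    ν * ν * tail + ν * e y (k ℕ.+ (ℓ ℕ.+ r)) * (ν * e y (k ℕ.+ 0)) * B
      ≈⟨ solve 5 (λ ν t a b B → ν :* ν :* t :+ ν :* a :* (ν :* b) :* B
           := ν :* ν :* (B :* (a :* b) :+ t)) refl ν tail _ _ B ⟩
    ν * ν * (B * (e y (k ℕ.+ (ℓ ℕ.+ r)) * e y (k ℕ.+ 0)) + tail)
      ≈⟨ *-congˡ (+-congʳ (*-congˡ product-full)) ⟩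
    ν * ν * (B * mono y (k ℕ.+ 0) (ℓ ℕ.+ r) + tail)
      ≈⟨ *-congˡ (sym product) ⟩
    ν * ν * (e y m * e y (k ℕ.+ r))
      ≈⟨ solve 3 (λ ν a b → ν :* ν :* (a :* b) := ν :* a :* (ν :* b)) refl ν _ _ ⟩
    ν * e y m * (ν * e y (k ℕ.+ r))
      ≈⟨ *-cong n*e-m n*e-k+r ⟩
    fromℕ (n C suc m) * fromℕ (n C ℓ) ∎
    where
    ν B : Carrier
    ν = fromℕ n
    B = fromℕ ((ℓ ℕ.+ r) C ℓ)

  -- After multiplication by `m + 1`, `C-absorb` turns `n C suc m` into `n` times `N C m`, and one
  -- factor `n` common to all terms is cancelled.
  tail-cleared : fromℕ (n ℕ.* suc m) * tail + fromℕ (N C m) * fromℕ (suc m C ℓ)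
                 ≈ fromℕ (N C m) * fromℕ (n C ℓ)
  tail-cleared = begin
    fromℕ (n ℕ.* suc m) * tail + G * B′
      ≈⟨ +-congʳ (*-congʳ (×1-homo-* n (suc m))) ⟩
    ν * s * tail + G * B′
      ≈⟨ trans (sym (*-identityˡ _)) (*-congʳ (sym (1/-inverse n))) ⟩
    1/ n * ν * (ν * s * tail + G * B′)
      ≈⟨ solve 6 (λ i ν s t G B → i :* ν :* (ν :* s :* t :+ G :* B)
           := i :* (ν :* ν :* t :* s :+ ν :* G :* B)) refl (1/ n) ν s tail G B′ ⟩
    1/ n * (ν * ν * tail * s + ν * G * B′)
      ≈⟨ *-congˡ (+-congˡ (*-congʳ (sym absorb))) ⟩
    1/ n * (ν * ν * tail * s + A * s * B′)
      ≈⟨ solve 5 (λ i T s A B → i :* (T :* s :+ A :* s :* B)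
           := i :* (s :* (T :+ A :* B))) refl (1/ n) _ s A B′ ⟩
    1/ n * (s * (ν * ν * tail + A * B′))
      ≈⟨ *-congˡ (*-congˡ tail-scaled) ⟩
    1/ n * (s * (A * D))
      ≈⟨ solve 4 (λ i s A D → i :* (s :* (A :* D)) := i :* (A :* s :* D)) refl (1/ n) s A D ⟩
    1/ n * (A * s * D)
      ≈⟨ *-congˡ (*-congʳ absorb) ⟩
    1/ n * (ν * G * D)
      ≈⟨ solve 4 (λ i ν G D → i :* (ν :* G :* D) := i :* ν :* (G :* D)) refl (1/ n) ν G D ⟩
    1/ n * ν * (G * D)
      ≈⟨ trans (*-congʳ (1/-inverse n)) (*-identityˡ _) ⟩
    G * D ∎
    where
    ν s A B′ D G : Carrier
    ν = fromℕ n
    s = fromℕ (suc m)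
    A = fromℕ (n C suc m)
    B′ = fromℕ (suc m C ℓ)
    D = fromℕ (n C ℓ)
    G = fromℕ (N C m)
    absorb : A * s ≈ ν * G
    absorb = trans (sym (×1-homo-* (n C suc m) (suc m)))
      (trans (reflexive (≡.cong fromℕ (C-absorb m r))) (×1-homo-* n (N C m)))

  tail-value : tail ≈ (1/ (n ℕ.* suc m)) {{m*n≢0 n (suc m)}} * fromℕ (N C m)
                      * (fromℕ (n C ℓ) - fromℕ (suc m C ℓ))
  tail-value = begin
    tail                  ≈⟨ sym (*-identityˡ tail) ⟩
    1# * tail             ≈⟨ *-congʳ (sym (1/-inverse (n ℕ.* suc m) {{m*n≢0 n (suc m)}})) ⟩
    i * fromℕ (n ℕ.* suc m) * tail
                          ≈⟨ *-assoc _ _ _ ⟩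
    i * (fromℕ (n ℕ.* suc m) * tail)
                          ≈⟨ *-congˡ difference ⟩
    i * (G * (D - B′))    ≈⟨ sym (*-assoc _ _ _) ⟩
    i * G * (D - B′)      ∎
    where
    i B′ D G : Carrier
    i = (1/ (n ℕ.* suc m)) {{m*n≢0 n (suc m)}}
    B′ = fromℕ (suc m C ℓ)
    D = fromℕ (n C ℓ)
    G = fromℕ (N C m)
    difference : fromℕ (n ℕ.* suc m) * tail ≈ G * (D - B′)
    difference = +-cancelʳ (G * B′) _ _ (begin
      fromℕ (n ℕ.* suc m) * tail + G * B′  ≈⟨ tail-cleared ⟩
      G * D                                ≈⟨ *-congˡ (sym (trans (+-congˡ (-‿inverseˡ B′)) (+-identityʳ D))) ⟩
      G * (D + (- B′ + B′))                ≈⟨ *-congˡ (sym (+-assoc D (- B′) B′)) ⟩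
      G * (D - B′ + B′)                    ≈⟨ distribˡ G (D - B′) B′ ⟩
      G * (D - B′) + G * B′                ∎)

  ones : ℕ → ℤ
  ones j = + n ℤ.- + m ℤ.+ + ℓ ℤ.- + 3 ℤ.- + 2 ℤ.* + j

  summand : ℕ → Carrier
  summand j = fromℤ (binomial (ones j) (+ ℓ ℤ.- + 1 ℤ.- + j))
    * 𝒴ᵇ ((+ 2 , + m ℤ.- + ℓ ℤ.+ + 1 ℤ.+ + j) ∷ (+ 1 , ones j) ∷ [])

  -- At `j = ℓ + d` the lower index of the binomial is `-(1 + d)`, so the coefficient is 0 even
  -- where the upper index is negative.
  summand-beyond : ∀ d → summand (ℓ ℕ.+ d) ≈ 0#
  summand-beyond d = begin
    summand (ℓ ℕ.+ d)
      ≡⟨ ≡.cong (λ b → fromℤ (binomial (ones (ℓ ℕ.+ d)) b) * Y) (negative (+ ℓ) (+ d)) ⟩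
    0# * Y  ≈⟨ zeroˡ Y ⟩
    0#      ∎
    where
    Y : Carrier
    Y = 𝒴ᵇ ((+ 2 , + m ℤ.- + ℓ ℤ.+ + 1 ℤ.+ + (ℓ ℕ.+ d)) ∷ (+ 1 , ones (ℓ ℕ.+ d)) ∷ [])
    negative : ∀ l d → l ℤ.- + 1 ℤ.- (l ℤ.+ d) ≡ ℤ.- (+ 1 ℤ.+ d)
    negative = ℤSolver.solve-∀

  summand-within : ∀ j p q → ℓ ≡ suc j ℕ.+ p → r ≡ suc j ℕ.+ q →
    summand j ≈ fromℕ ((p ℕ.+ q) C p) * mono y (k ℕ.+ suc j) (p ℕ.+ q)
  summand-within j p q ℓ≡ r≡ = begin
    summand j
      ≡⟨ ≡.cong₂ (λ o b → fromℤ (binomial o b) * 𝒴ᵇ ((+ 2 , + m ℤ.- + ℓ ℤ.+ + 1 ℤ.+ + j) ∷ (+ 1 , o) ∷ []))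
           ones≡ bottom≡ ⟩
    fromℕ ((p ℕ.+ q) C p) * 𝒴ᵇ ((+ 2 , + m ℤ.- + ℓ ℤ.+ + 1 ℤ.+ + j) ∷ (+ 1 , + (p ℕ.+ q)) ∷ [])
      ≡⟨ ≡.cong (λ t → fromℕ ((p ℕ.+ q) C p) * 𝒴ᵇ ((+ 2 , t) ∷ (+ 1 , + (p ℕ.+ q)) ∷ []))
           (twos (+ k) (+ ℓ) (+ j)) ⟩
    fromℕ ((p ℕ.+ q) C p) * 𝒴 (sorted (k ℕ.+ suc j) (p ℕ.+ q))
      ≈⟨ *-congˡ (𝒴-mono (k ℕ.+ suc j) (p ℕ.+ q)) ⟩
    fromℕ ((p ℕ.+ q) C p) * mono y (k ℕ.+ suc j) (p ℕ.+ q) ∎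
    where
    bottom : ∀ j p → + 1 ℤ.+ j ℤ.+ p ℤ.- + 1 ℤ.- j ≡ p
    bottom = ℤSolver.solve-∀
    bottom≡ : + ℓ ℤ.- + 1 ℤ.- + j ≡ + p
    bottom≡ = ≡.trans (≡.cong (λ l → + l ℤ.- + 1 ℤ.- + j) ℓ≡) (bottom (+ j) (+ p))
    top : ∀ k j p q → + 1 ℤ.+ (k ℤ.+ (+ 1 ℤ.+ j ℤ.+ p) ℤ.+ (+ 1 ℤ.+ j ℤ.+ q)) ℤ.- (k ℤ.+ (+ 1 ℤ.+ j ℤ.+ p))
      ℤ.+ (+ 1 ℤ.+ j ℤ.+ p) ℤ.- + 3 ℤ.- + 2 ℤ.* j ≡ p ℤ.+ q
    top = ℤSolver.solve-∀
    ones≡ : ones j ≡ + (p ℕ.+ q)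
    ones≡ = ≡.trans
      (≡.cong₂ (λ l r → + suc (k ℕ.+ l ℕ.+ r) ℤ.- + (k ℕ.+ l) ℤ.+ + l ℤ.- + 3 ℤ.- + 2 ℤ.* + j) ℓ≡ r≡)
      (top (+ k) (+ j) (+ p) (+ q))
    twos : ∀ k l j → k ℤ.+ l ℤ.- l ℤ.+ + 1 ℤ.+ j ≡ k ℤ.+ (+ 1 ℤ.+ j)
    twos = ℤSolver.solve-∀

  summand-sum : sum {n ∸ suc m} (summand ∘ toℕ) ≈ tail
  -- The number of terms, `n ∸ suc m`, is `r`.
  summand-sum = ≡.subst (λ s → sum {s} (summand ∘ toℕ) ≈ tail) (≡.sym (ℕ.m+n∸m≡n m r))
    (sum-expand (λ a b → mono y (k ℕ.+ suc a) b) summand ℓ r summand-beyond summand-within)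

-- The case ℓ = 1

module Single {c ℓ₁ ℓ₂} (K : HeytingField c ℓ₁ ℓ₂) (char0 : FieldOps.CharacteristicZero K) where

  open FieldOps K using (commutativeRing; fromℕ; fromℤ; IsPrimitiveRoot)
  open CommutativeRing commutativeRing hiding (zero)
  open RingProperties ring
  open Mult semiring using (×-homo-+)
  open SetoidReasoning setoid

  -- For `ℓ = 1` the tail has at most one term, with coefficient 1. For `r = 0`, that is m = n - 1,
  -- it is empty, and on the other side the block of ones has length -1, so `𝒴ᵇ` is 0 by convention.
  single-tail : ∀ k r ζ (prim : IsPrimitiveRoot (suc (k ℕ.+ 1 ℕ.+ r)) ζ) →
    CyclotomicSums.𝒴ᵇ K char0 (suc (k ℕ.+ 1 ℕ.+ r)) ζ prim
      ((+ 2 , + (k ℕ.+ 1)) ∷ (+ 1 , + suc (k ℕ.+ 1 ℕ.+ r) ℤ.- + (k ℕ.+ 1) ℤ.- + 2) ∷ [])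
    ≈ Expansion.tail K char0 k 1 r ζ prim
  single-tail k zero ζ prim = reflexive
    (≡.cong (λ b → CyclotomicSums.𝒴ᵇ K char0 (suc (k ℕ.+ 1 ℕ.+ 0)) ζ prim ((+ 2 , + (k ℕ.+ 1)) ∷ (+ 1 , b) ∷ []))
      (negative (+ (k ℕ.+ 1))))
    where
    negative : ∀ x → + 1 ℤ.+ (x ℤ.+ + 0) ℤ.- x ℤ.- + 2 ≡ ℤ.- + 1
    negative = ℤSolver.solve-∀
  single-tail k (suc r) ζ prim = begin
    𝒴ᵇ ((+ 2 , + (k ℕ.+ 1)) ∷ (+ 1 , + suc (k ℕ.+ 1 ℕ.+ suc r) ℤ.- + (k ℕ.+ 1) ℤ.- + 2) ∷ [])
      ≡⟨ ≡.cong (λ b → 𝒴ᵇ ((+ 2 , + (k ℕ.+ 1)) ∷ (+ 1 , b) ∷ [])) (ones (+ (k ℕ.+ 1)) (+ r)) ⟩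
    𝒴 (sorted (k ℕ.+ 1) r)         ≈⟨ 𝒴-mono (k ℕ.+ 1) r ⟩
    mono y (k ℕ.+ 1) r             ≈⟨ sym (trans (*-congʳ (+-identityʳ 1#)) (*-identityˡ _)) ⟩
    fromℕ 1 * mono y (k ℕ.+ 1) r   ≈⟨ sym (+-identityʳ _) ⟩
    Expansion.tail K char0 k 1 (suc r) ζ prim ∎
    where
    open CyclotomicSums K char0 (suc (k ℕ.+ 1 ℕ.+ suc r)) ζ prim using (𝒴; 𝒴ᵇ)
    open Cyclotomic K char0 (k ℕ.+ 1 ℕ.+ suc r) ζ prim using (y; 𝒴-mono)
    open SymmetricSums commutativeSemiring using (mono)
    ones : ∀ x r → + 1 ℤ.+ (x ℤ.+ (+ 1 ℤ.+ r)) ℤ.- x ℤ.- + 2 ≡ r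
    ones = ℤSolver.solve-∀

  fromℕ-C1-difference : ∀ m r →
    fromℕ (suc (m ℕ.+ r) C 1) - fromℕ (suc m C 1) ≈ fromℤ (+ suc (m ℕ.+ r) ℤ.- + m ℤ.- + 1)
  fromℕ-C1-difference m r = begin
    fromℕ (suc (m ℕ.+ r) C 1) - fromℕ (suc m C 1)
      ≡⟨ ≡.cong₂ (λ a b → fromℕ a - fromℕ b) (nC1≡n (suc (m ℕ.+ r))) (nC1≡n (suc m)) ⟩
    fromℕ (suc m ℕ.+ r) - fromℕ (suc m)
      ≈⟨ +-congʳ (trans (×-homo-+ 1# (suc m) r) (+-comm _ _)) ⟩
    fromℕ r + fromℕ (suc m) - fromℕ (suc m)
      ≈⟨ trans (+-assoc _ _ _) (trans (+-congˡ (-‿inverseʳ _)) (+-identityʳ _)) ⟩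
    fromℕ r
      ≡⟨ ≡.cong fromℤ (≡.sym (cancel (+ m) (+ r))) ⟩
    fromℤ (+ suc (m ℕ.+ r) ℤ.- + m ℤ.- + 1) ∎
    where
    cancel : ∀ m r → + 1 ℤ.+ (m ℤ.+ r) ℤ.- m ℤ.- + 1 ≡ r
    cancel = ℤSolver.solve-∀

theorem2 : ∀ {c ℓ₁ ℓ₂} (K : HeytingField c ℓ₁ ℓ₂) (char0 : FieldOps.CharacteristicZero K)
    (n : ℕ) .{{_ : NonZero n}}
    (ζ : HeytingField.Carrier K) (prim : FieldOps.IsPrimitiveRoot K n ζ) →
    let open CyclotomicSums K char0 n ζ prim in
    (∀ m ℓ → m ≤ pred n → ℓ ≤ m →
    ∑[ j < n ∸ suc m ]
    (fromℤ (binomial (+ n ℤ.- + m ℤ.+ + ℓ ℤ.- + 3 ℤ.- + 2 ℤ.* + toℕ j) (+ ℓ ℤ.- + 1 ℤ.- + toℕ j))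
    * 𝒴ᵇ ((+ 2 , + m ℤ.- + ℓ ℤ.+ + 1 ℤ.+ + toℕ j)
    ∷ (+ 1 , + n ℤ.- + m ℤ.+ + ℓ ℤ.- + 3 ℤ.- + 2 ℤ.* + toℕ j) ∷ []))
    ≈ (1/ (n ℕ.* suc m)) {{m*n≢0 n (suc m)}} * fromℕ (pred n C m)
    * (fromℕ (n C ℓ) - fromℕ (suc m C ℓ)))
    ×
    (∀ m → m ≤ pred n → 1 ≤ m →
    𝒴ᵇ ((+ 2 , + m) ∷ (+ 1 , + n ℤ.- + m ℤ.- + 2) ∷ [])
    ≈ fromℤ (+ n ℤ.- + m ℤ.- + 1) * (1/ (n ℕ.* suc m)) {{m*n≢0 n (suc m)}} * fromℕ (pred n C m))
theorem2 K char0 (suc N) ζ prim = general , special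
  where
  open CyclotomicSums K char0 (suc N) ζ prim
  open CommutativeRing commutativeRing using (sym; trans; *-comm; *-assoc; *-congˡ)

  general : ∀ m ℓ → m ≤ N → ℓ ≤ m → _
  -- The witnesses are `k = m - ℓ` and `r = N - m`. The equation for `k` is commuted before matching
  -- because `Expansion` writes `m` as `k + ℓ`.
  general m ℓ m≤N ℓ≤m with ℕ.m≤n⇒∃[o]m+o≡n ℓ≤m | ℕ.m≤n⇒∃[o]m+o≡n m≤N
  ... | k , eq | r , ≡.refl with ≡.trans (ℕ.+-comm k ℓ) eq
  ... | ≡.refl = trans (Expansion.summand-sum K char0 k ℓ r ζ prim) (Expansion.tail-value K char0 k ℓ r ζ prim)

  special : ∀ m → m ≤ N → 1 ≤ m → _
  special m m≤N 1≤m with ℕ.m≤n⇒∃[o]m+o≡n 1≤m | ℕ.m≤n⇒∃[o]m+o≡n m≤N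
  ... | k , eq | r , ≡.refl with ≡.trans (ℕ.+-comm k 1) eq
  ... | ≡.refl = trans (Single.single-tail K char0 k r ζ prim)
    (trans (Expansion.tail-value K char0 k 1 r ζ prim)
    (trans (*-congˡ (Single.fromℕ-C1-difference K char0 (k ℕ.+ 1) r))
    (trans (*-comm _ _) (sym (*-assoc _ _ _)))))
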